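{- There is an absolute constant $C>0$ such that for every $d\ge1$ and every degree-$d$ polynomial threshold function $f:\{1,-1\}^n\to\{1,-1\}$ (i.e. $f=\mathrm{sign}(P)$ for a real polynomial $P$ of degree at most $d$), $$\mathbb{AS}(f)\le 2^{Cd}\, n^{1-1/(4d+6)}.$$
   Context: For $f:\{1,-1\}^n\to\{1,-1\}$, $X$ uniform on $\{1,-1\}^n$, and $X^{(i)}$ equal to $X$ with the $i$-th coordinate negated, the influence of coordinate $i$ is $\mathbb{I}_i(f)=\Pr[f(X)\neq f(X^{(i)})]$, and the average sensitivity is $\mathbb{AS}(f)=\sum_{i=1}^n\mathbb{I}_i(f)$. The sign function maps reals to $\{1,-1\}$ with some fixed convention at $0$.
   Formalization: The polynomial P defining the threshold function is taken with rational rather than real coefficients; the bound is stated with both sides raised to the power 4d+6. -}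

module Defs where

open import Data.Bool using (Bool; true; false; not; if_then_else_)
open import Data.Nat as ℕ using (ℕ; zero; suc)
open import Data.Fin using (Fin)
open import Data.Vec using (Vec; []; _∷_; updateAt; zipWith; foldr)
open import Data.List as List using (List; []; _∷_; _++_)
open import Data.List.Relation.Unary.All using (All)
open import Data.Product using (_×_; _,_; proj₁; proj₂; Σ)
open import Data.Rational using (ℚ; 0ℚ; 1ℚ; ½; -_; _+_; _*_; _<_)
open import Data.Rational.Properties using (_<?_)
open import Relation.Nullary using (yes; no)
open import Relation.Binary.PropositionalEquality using (_≡_)

-- The Boolean cube {1,-1}^n: true encodes 1, false encodes -1.
Cube : ℕ → Set
Cube n = Vec Bool n

allPoints : (n : ℕ) → List (Cube n)
allPoints zero = [] ∷ []
allPoints (suc n) = List.map (true ∷_) (allPoints n) ++ List.map (false ∷_) (allPoints n)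

flipAt : {n : ℕ} → Fin n → Cube n → Cube n
flipAt i x = updateAt x i not

_^ℚ_ : ℚ → ℕ → ℚ
q ^ℚ zero = 1ℚ
q ^ℚ suc k = q * (q ^ℚ k)

ℕtoℚ : ℕ → ℚ
ℕtoℚ zero = 0ℚ
ℕtoℚ (suc k) = 1ℚ + ℕtoℚ k

countWhere : {A : Set} → (A → Bool) → List A → ℕ
countWhere p [] = 0
countWhere p (a ∷ as) = if p a then suc (countWhere p as) else countWhere p as

differ : Bool → Bool → Bool
differ true true = false
differ false false = false
differ _ _ = true

influence : {n : ℕ} → (Cube n → Bool) → Fin n → ℚ
influence {n} f i =
  ℕtoℚ (countWhere (λ x → differ (f x) (f (flipAt i x))) (allPoints n)) * (½ ^ℚ n)

sumFin : (n : ℕ) → (Fin n → ℚ) → ℚ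
sumFin zero g = 0ℚ
sumFin (suc n) g = g Fin.zero + sumFin n (λ i → g (Fin.suc i))

averageSensitivity : {n : ℕ} → (Cube n → Bool) → ℚ
averageSensitivity {n} f = sumFin n (influence f)

-- Real polynomials in x_1..x_n (general, not necessarily multilinear):
-- a finite list of monomials (coefficient, exponent vector).
Monomial : ℕ → Set
Monomial n = ℚ × Vec ℕ n

Polynomial : ℕ → Set
Polynomial n = List (Monomial n)

monoDegree : {n : ℕ} → Monomial n → ℕ
monoDegree (c , e) = foldr (λ _ → ℕ) ℕ._+_ 0 e

DegreeAtMost : {n : ℕ} → ℕ → Polynomial n → Set
DegreeAtMost d P = All (λ m → monoDegree m ℕ.≤ d) P

val : Bool → ℚ
val true = 1ℚ
val false = - 1ℚ

evalMono : {n : ℕ} → Monomial n → Cube n → ℚ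
evalMono (c , e) x = c * foldr (λ _ → ℚ) _*_ 1ℚ (zipWith (λ b k → val b ^ℚ k) x e)

evalPoly : {n : ℕ} → Polynomial n → Cube n → ℚ
evalPoly P x = List.foldr (λ m acc → evalMono m x + acc) 0ℚ P

sgn : Bool → ℚ → Bool
sgn s0 q with 0ℚ <? q
... | yes _ = true
... | no _ with q <? 0ℚ
...   | yes _ = false
...   | no _ = s0

IsPTF : {n : ℕ} → Bool → ℕ → (Cube n → Bool) → Set
IsPTF {n} s0 d f = Σ (Polynomial n) λ P → DegreeAtMost d P × ((x : Cube n) → f x ≡ sgn s0 (evalPoly P x))

{-# OPTIONS --safe #-}
-- Let ε_d(n) be the largest value of AS(f)/n over degree-d PTFs f = sign P on n variables.
-- With g_i = sign(∂_i P), a PTF of degree d − 1 not depending on x_i, the influence of i is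
-- E[f(x) x_i g_i(x)].  Colour the coordinates with k colours at random, and in g_i resample
-- (from an independent copy of x) the colour class B containing i.  Once this is done the
-- terms x_i g_i, i ∈ B, are orthogonal, so their sum correlates with f by at most √|B|, in
-- total at most √(kn).  The replacement costs at most twice the probability that resampling
-- changes g_i; giving each colour class one common bit that selects between the two copies
-- turns g_i into a PTF of degree d − 1 on k variables, so this probability is on average at
-- most ε_{d−1}(k).  Hence ε_d(n) ≤ √(k/n) + 2 ε_{d−1}(k), and iterating over the dimensions
-- 1, r², r⁴, …, r^{2d} ≤ n gives ε_d(n) ≤ 2^d / r, which is O(2^d n^{−1/(2d)}).
-- The square roots are avoided by f Y ≤ (Y²/r + r)/2.
module Submission where

open import Defs
open import Data.Bool using (Bool; true; false; not; if_then_else_)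
open import Data.Empty using (⊥-elim)
open import Data.Fin using (Fin; zero; suc; _≟_)
open import Data.List as List using (List; []; _∷_; _++_)
open import Data.List.Relation.Unary.All using ([]; _∷_)
open import Data.Nat as ℕ using (ℕ; zero; suc; z≤n; s≤s)
import Data.Nat.Properties as ℕ
open import Data.Nat.Solver using () renaming (module +-*-Solver to ℕ-Solver)
open import Data.Product using (Σ; ∃-syntax; _×_; _,_; proj₁; proj₂; swap)
open import Data.Rational using (ℚ; 0ℚ; 1ℚ; ½; _≤_)
open import Data.Rational.Solver using (module +-*-Solver)
open import Data.Sum using (inj₁; inj₂)
open import Data.Vec using (Vec; []; _∷_; lookup; map; zipWith; tail; foldr; _[_]≔_)
open import Data.Vec.Properties
  using (lookup∘update; lookup∘update′; lookup∘updateAt; lookup∘updateAt′; []≔-idempotent; map-[]≔)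
open import Function using (_∘_; id)
open import Relation.Binary.PropositionalEquality
  using (_≡_; _≢_; refl; sym; trans; cong; cong₂; subst; module ≡-Reasoning)
open import Relation.Nullary using (yes; no; ⌊_⌋)

module Sensitivity where

  open import Data.Rational
    using (-_; _+_; _-_; _*_; _<_; 1/_; NonNegative; Positive; nonNegative; nonPositive)
  open import Data.Rational.Properties hiding (_≟_)
  open +-*-Solver using (solve; con; _:+_; _:*_; _:-_; _:=_)
  open ℕ-Solver using ()
    renaming (solve to ℕ-solve; con to ℕcon; _:+_ to _ℕ:+_; _:*_ to _ℕ:*_; _:=_ to _ℕ:=_)

  private
    variable
      A B : Set
      m n k d : ℕ

  -- Expectations over finite product spaces

  -- Finite sums and expectations are both instances, so one exchange law covers sum against
  -- expectation and expectation against expectation.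
  record Linear {T : Set} (L : (T → ℚ) → ℚ) : Set where
    field
      L-cong : ∀ {F G} → (∀ t → F t ≡ G t) → L F ≡ L G
      L-+    : ∀ F G → L (λ t → F t + G t) ≡ L F + L G
      L-*    : ∀ c F → L (λ t → c * F t) ≡ c * L F

    L-0 : L (λ _ → 0ℚ) ≡ 0ℚ
    L-0 = trans (L-cong λ _ → sym (*-zeroˡ 0ℚ)) (trans (L-* 0ℚ (λ _ → 0ℚ)) (*-zeroˡ (L (λ _ → 0ℚ))))

  open Linear

  sumFin-linear : ∀ n → Linear (sumFin n)
  sumFin-linear n = record { L-cong = cg n ; L-+ = plus n ; L-* = scale n }
    where
    cg : ∀ n {F G : Fin n → ℚ} → (∀ i → F i ≡ G i) → sumFin n F ≡ sumFin n G
    cg zero    F≗G = refl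
    cg (suc n) F≗G = cong₂ _+_ (F≗G zero) (cg n (F≗G ∘ suc))

    plus : ∀ n (F G : Fin n → ℚ) → sumFin n (λ i → F i + G i) ≡ sumFin n F + sumFin n G
    plus zero    F G = refl
    plus (suc n) F G = trans (cong (F zero + G zero +_) (plus n (F ∘ suc) (G ∘ suc)))
      (solve 4 (λ a b c d → (a :+ b) :+ (c :+ d) := (a :+ c) :+ (b :+ d)) refl
        (F zero) (G zero) (sumFin n (F ∘ suc)) (sumFin n (G ∘ suc)))

    scale : ∀ n c (F : Fin n → ℚ) → sumFin n (λ i → c * F i) ≡ c * sumFin n F
    scale zero    c F = sym (*-zeroʳ c)
    scale (suc n) c F = trans (cong (c * F zero +_) (scale n c (F ∘ suc)))
      (sym (*-distribˡ-+ c (F zero) (sumFin n (F ∘ suc))))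

  sumFin-mono : ∀ n {F G : Fin n → ℚ} → (∀ i → F i ≤ G i) → sumFin n F ≤ sumFin n G
  sumFin-mono zero    F≤G = ≤-refl
  sumFin-mono (suc n) F≤G = +-mono-≤ (F≤G zero) (sumFin-mono n (F≤G ∘ suc))

  sumFin-const : ∀ n c → sumFin n (λ _ → c) ≡ ℕtoℚ n * c
  sumFin-const zero    c = sym (*-zeroˡ c)
  sumFin-const (suc n) c = trans (cong (c +_) (sumFin-const n c))
    (solve 2 (λ c m → c :+ m :* c := (con 1ℚ :+ m) :* c) refl c (ℕtoℚ n))

  L-sumFin : ∀ {L : (A → ℚ) → ℚ} → Linear L → ∀ n (F : A → Fin n → ℚ) →
    L (λ t → sumFin n (F t)) ≡ sumFin n (λ i → L (λ t → F t i))
  L-sumFin lin zero    F = L-0 lin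
  L-sumFin {L = L} lin (suc n) F = trans (L-+ lin (λ t → F t zero) _)
    (cong (L (λ t → F t zero) +_) (L-sumFin lin n (λ t → F t ∘ suc)))

  -- A distribution is encoded by its expectation functional, so products of distributions are
  -- nested expectations. `fubini` is a field: every mean built below is a finite combination of
  -- evaluations, and these commute with any linear functional.
  record Mean (A : Set) : Set₁ where
    field
      E       : (A → ℚ) → ℚ
      linear  : Linear E
      E-const : ∀ c → E (λ _ → c) ≡ c
      E-mono  : ∀ {F G} → (∀ a → F a ≤ G a) → E F ≤ E G
      fubini  : ∀ {T} {L : (T → ℚ) → ℚ} → Linear L → (F : T → A → ℚ) →
                L (λ t → E (F t)) ≡ E (λ a → L (λ t → F t a))

  open Mean

  E-cong : (μ : Mean A) {F G : A → ℚ} → (∀ a → F a ≡ G a) → E μ F ≡ E μ G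
  E-cong μ = L-cong (linear μ)

  bit : Mean Bool
  bit = record
    { E       = λ F → ½ * (F true + F false)
    ; linear  = record
      { L-cong = λ F≗G → cong₂ (λ a b → ½ * (a + b)) (F≗G true) (F≗G false)
      ; L-+    = λ F G → solve 4 (λ a b c d → con ½ :* ((a :+ b) :+ (c :+ d)) :=
                   con ½ :* (a :+ c) :+ con ½ :* (b :+ d)) refl (F true) (G true) (F false) (G false)
      ; L-*    = λ c F → solve 3 (λ c a b → con ½ :* (c :* a :+ c :* b) := c :* (con ½ :* (a :+ b)))
                   refl c (F true) (F false)
      }
    ; E-const = solve 1 (λ c → con ½ :* (c :+ c) := c) refl
    ; E-mono  = λ F≤G → *-monoˡ-≤-nonNeg ½ (+-mono-≤ (F≤G true) (F≤G false))
    ; fubini  = λ lin F → trans (L-* lin ½ _) (cong (½ *_) (L-+ lin _ _))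
    }

  ℕtoℚ-+ : ∀ a b → ℕtoℚ (a ℕ.+ b) ≡ ℕtoℚ a + ℕtoℚ b
  ℕtoℚ-+ zero    b = sym (+-identityˡ (ℕtoℚ b))
  ℕtoℚ-+ (suc a) b = trans (cong (1ℚ +_) (ℕtoℚ-+ a b)) (sym (+-assoc 1ℚ (ℕtoℚ a) (ℕtoℚ b)))

  ℕtoℚ-* : ∀ a b → ℕtoℚ (a ℕ.* b) ≡ ℕtoℚ a * ℕtoℚ b
  ℕtoℚ-* zero    b = sym (*-zeroˡ (ℕtoℚ b))
  ℕtoℚ-* (suc a) b = trans (ℕtoℚ-+ b (a ℕ.* b)) (trans (cong (ℕtoℚ b +_) (ℕtoℚ-* a b))
    (solve 2 (λ a b → b :+ a :* b := (con 1ℚ :+ a) :* b) refl (ℕtoℚ a) (ℕtoℚ b)))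

  ℕtoℚ-nonNeg : ∀ a → NonNegative (ℕtoℚ a)
  ℕtoℚ-nonNeg zero    = _
  ℕtoℚ-nonNeg (suc a) = nonNeg+nonNeg⇒nonNeg 1ℚ (ℕtoℚ a) {{ℕtoℚ-nonNeg a}}

  ℕtoℚ-pos : ∀ a → Positive (ℕtoℚ (suc a))
  ℕtoℚ-pos a = pos+nonNeg⇒pos 1ℚ (ℕtoℚ a) {{ℕtoℚ-nonNeg a}}

  -- The shift by one keeps nonzero side conditions out of later statements.
  recip : ℕ → ℚ
  recip k = (1/ ℕtoℚ (suc k)) {{pos⇒nonZero (ℕtoℚ (suc k)) {{ℕtoℚ-pos k}}}}

  recip-pos : ∀ k → Positive (recip k)
  recip-pos k = 1/pos⇒pos (ℕtoℚ (suc k)) {{ℕtoℚ-pos k}}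

  recip-* : ∀ k → recip k * ℕtoℚ (suc k) ≡ 1ℚ
  recip-* k = *-inverseˡ (ℕtoℚ (suc k)) {{pos⇒nonZero (ℕtoℚ (suc k)) {{ℕtoℚ-pos k}}}}

  fin : ∀ k → Mean (Fin (suc k))
  fin k = record
    { E       = λ F → recip k * sumFin (suc k) F
    ; linear  = record
      { L-cong = λ F≗G → cong (recip k *_) (L-cong sumᴸ F≗G)
      ; L-+    = λ F G → trans (cong (recip k *_) (L-+ sumᴸ F G)) (*-distribˡ-+ (recip k) _ _)
      ; L-*    = λ c F → trans (cong (recip k *_) (L-* sumᴸ c F))
                   (solve 3 (λ a b c → a :* (b :* c) := b :* (a :* c)) refl (recip k) c _)
      }
    ; E-const = λ c → trans (cong (recip k *_) (sumFin-const (suc k) c))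
                  (trans (sym (*-assoc (recip k) _ c))
                  (trans (cong (_* c) (recip-* k)) (*-identityˡ c)))
    ; E-mono  = λ F≤G → *-monoˡ-≤-nonNeg (recip k)
                  {{pos⇒nonNeg (recip k) {{recip-pos k}}}} (sumFin-mono (suc k) F≤G)
    ; fubini  = λ lin F → trans (L-* lin (recip k) _) (cong (recip k *_) (L-sumFin lin (suc k) F))
    }
    where
    sumᴸ : Linear (sumFin (suc k))
    sumᴸ = sumFin-linear (suc k)

  infixr 4 _⊗_
  _⊗_ : Mean A → Mean B → Mean (A × B)
  μ ⊗ ν = record
    { E       = λ F → E μ λ a → E ν λ b → F (a , b)
    ; linear  = record
      { L-cong = λ F≗G → E-cong μ λ a → E-cong ν λ b → F≗G (a , b)
      ; L-+    = λ F G → trans (E-cong μ λ a → L-+ (linear ν) _ _) (L-+ (linear μ) _ _)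
      ; L-*    = λ c F → trans (E-cong μ λ a → L-* (linear ν) c _) (L-* (linear μ) c _)
      }
    ; E-const = λ c → trans (E-cong μ λ _ → E-const ν c) (E-const μ c)
    ; E-mono  = λ F≤G → E-mono μ λ a → E-mono ν λ b → F≤G (a , b)
    ; fubini  = λ lin F → trans (fubini μ lin _) (E-cong μ λ a → fubini ν lin _)
    }

  push : (A → B) → Mean A → Mean B
  push h μ = record
    { E       = λ F → E μ (F ∘ h)
    ; linear  = record
      { L-cong = λ F≗G → E-cong μ (F≗G ∘ h)
      ; L-+    = λ F G → L-+ (linear μ) (F ∘ h) (G ∘ h)
      ; L-*    = λ c F → L-* (linear μ) c (F ∘ h)
      }
    ; E-const = E-const μ
    ; E-mono  = λ F≤G → E-mono μ (F≤G ∘ h)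
    ; fubini  = λ lin F → fubini μ lin (λ t → F t ∘ h)
    }

  point : A → Mean A
  point a = record
    { E       = λ F → F a
    ; linear  = record { L-cong = λ F≗G → F≗G a ; L-+ = λ _ _ → refl ; L-* = λ _ _ → refl }
    ; E-const = λ _ → refl
    ; E-mono  = λ F≤G → F≤G a
    ; fubini  = λ _ _ → refl
    }

  vec : Mean A → ∀ n → Mean (Vec A n)
  vec μ zero    = point []
  vec μ (suc n) = push (λ (a , v) → a ∷ v) (μ ⊗ vec μ n)

  -- The coordinates are independent, so redrawing one from its own law leaves the joint law
  -- unchanged. This isolates a single coordinate inside an expectation.
  E-resample : (μ : Mean A) (i : Fin n) (F : Vec A n → ℚ) →
    E (vec μ n) F ≡ E (vec μ n) (λ v → E μ (λ a → F (v [ i ]≔ a)))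
  E-resample {n = suc n} μ zero F =
    trans (fubini (vec μ n) (linear μ) λ a v → F (a ∷ v)) (sym (E-const μ _))
  E-resample μ (suc i) F = E-cong μ λ a → E-resample μ i (F ∘ (a ∷_))

  -- The coordinates are independent, so law-preserving maps may act on them separately. The use is
  -- with `σ` exchanging the two copies of a bit depending on its colour.
  E-zipWith : (μ : Mean A) (σ : B → A → A) → (∀ b F → E μ (F ∘ σ b) ≡ E μ F) →
    (bs : Vec B n) (F : Vec A n → ℚ) → E (vec μ n) (F ∘ zipWith σ bs) ≡ E (vec μ n) F
  E-zipWith μ σ inv []       F = refl
  E-zipWith {n = suc n} μ σ inv (b ∷ bs) F = trans
    (E-cong μ λ a → E-zipWith μ σ inv bs (F ∘ (σ b a ∷_)))
    (inv b λ a → E (vec μ n) (F ∘ (a ∷_)))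

  E-map : (μ : Mean A) (ν : Mean B) (h : A → B) → (∀ F → E μ (F ∘ h) ≡ E ν F) →
    ∀ n (F : Vec B n → ℚ) → E (vec μ n) (F ∘ map h) ≡ E (vec ν n) F
  E-map μ ν h push zero    F = refl
  E-map μ ν h push (suc n) F = trans
    (E-cong μ λ a → E-map μ ν h push n (F ∘ (h a ∷_)))
    (push λ b → E (vec ν n) (F ∘ (b ∷_)))

  -- Degree and signs

  -- Degree as a property of functions on the cube rather than of coefficient lists: derivatives and
  -- substitutions are then handled by induction, and `resp` absorbs all algebraic rearrangement.
  data Degree≤ {n : ℕ} : ℕ → (Cube n → ℚ) → Set where
    const  : ∀ c → Degree≤ d (λ _ → c)
    plus   : ∀ {p q} → Degree≤ d p → Degree≤ d q → Degree≤ d (λ x → p x + q x)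
    times  : ∀ i {p} → Degree≤ d p → Degree≤ (suc d) (λ x → val (lookup x i) * p x)
    resp   : ∀ {p q} → (∀ x → p x ≡ q x) → Degree≤ d p → Degree≤ d q

  scale : ∀ a {p : Cube n → ℚ} → Degree≤ d p → Degree≤ d (λ x → a * p x)
  scale a (const c)   = const (a * c)
  scale a (plus p q)  = resp (λ _ → sym (*-distribˡ-+ a _ _)) (plus (scale a p) (scale a q))
  scale a (times i {p = p} P) = resp
    (λ x → solve 3 (λ v a p → v :* (a :* p) := a :* (v :* p)) refl (val (lookup x i)) a (p x))
    (times i (scale a P))
  scale a (resp e p)  = resp (λ x → cong (a *_) (e x)) (scale a p)

  weaken : {p : Cube n → ℚ} → Degree≤ d p → Degree≤ (suc d) p
  weaken (const c)   = const c
  weaken (plus p q)  = plus (weaken p) (weaken q)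
  weaken (times i p) = times i (weaken p)
  weaken (resp e p)  = resp e (weaken p)

  weaken* : ∀ {d e} {p : Cube n → ℚ} → d ℕ.≤′ e → Degree≤ d p → Degree≤ e p
  weaken* (ℕ.≤′-reflexive refl) p = p
  weaken* (ℕ.≤′-step d≤e)       p = weaken (weaken* d≤e p)

  degree0-constant : {p : Cube n → ℚ} → Degree≤ 0 p → ∀ x y → p x ≡ p y
  degree0-constant (const c)  x y = refl
  degree0-constant (plus p q) x y = cong₂ _+_ (degree0-constant p x y) (degree0-constant q x y)
  degree0-constant (resp e p) x y =
    trans (sym (e x)) (trans (degree0-constant p x y) (e y))

  AffineIn : (Cube m → ℚ) → Fin m → Set
  AffineIn h j = ∃[ α ] ∃[ β ] ∀ z → h z ≡ α + β * val (lookup z j)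

  -- Each variable becomes an affine function of a single new variable, possibly a constant one, so
  -- no product gains degree. Fixing a coordinate and passing to selector bits are both of this
  -- kind.
  substitute : (σ : Cube m → Cube n) → (∀ i → ∃[ j ] AffineIn (λ z → val (lookup (σ z) i)) j) →
    {p : Cube n → ℚ} → Degree≤ d p → Degree≤ d (p ∘ σ)
  substitute σ aff (const c)   = const c
  substitute σ aff (plus p q)  = plus (substitute σ aff p) (substitute σ aff q)
  substitute σ aff (resp e p)  = resp (e ∘ σ) (substitute σ aff p)
  substitute σ aff (times i {p = p} P) with aff i
  ... | j , α , β , eq = resp
    (λ z → trans
      (solve 4 (λ α β v p → α :* p :+ β :* (v :* p) := (α :+ β :* v) :* p) refl
        α β (val (lookup z j)) (p (σ z)))
      (cong (_* p (σ z)) (sym (eq z))))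
    (plus (scale α (weaken P∘σ)) (scale β (times j P∘σ)))
    where P∘σ = substitute σ aff P

  restrict-affine : ∀ (i : Fin n) b j → ∃[ l ] AffineIn (λ z → val (lookup (z [ i ]≔ b) j)) l
  restrict-affine i b j with j ≟ i
  ... | yes refl = i , val b , 0ℚ , λ z → trans (cong val (lookup∘update i z b))
    (solve 2 (λ b v → b := b :+ con 0ℚ :* v) refl (val b) (val (lookup z i)))
  ... | no j≢i   = j , 0ℚ , 1ℚ , λ z → trans (cong val (lookup∘update′ j≢i z b))
    (solve 1 (λ v → v := con 0ℚ :+ con 1ℚ :* v) refl (val (lookup z j)))

  restrict : ∀ (i : Fin n) b {p} → Degree≤ d p → Degree≤ d (λ x → p (x [ i ]≔ b))
  restrict i b = substitute (_[ i ]≔ b) (restrict-affine i b)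

  -- Twice the usual discrete derivative; only its sign matters.
  ∂ : Fin n → (Cube n → ℚ) → Cube n → ℚ
  ∂ i p x = p (x [ i ]≔ true) - p (x [ i ]≔ false)

  -- For a product of `x_j` and `p`, differentiating at `j` itself leaves the sum of the two
  -- restrictions of `p`; at any other coordinate the factor `x_j` passes through the derivative.
  ∂-degree : ∀ (i : Fin n) {p} → Degree≤ (suc d) p → Degree≤ d (∂ i p)
  ∂-degree i (const c)  = resp (λ _ → sym (+-inverseʳ c)) (const 0ℚ)
  ∂-degree i (plus {p = p} {q = q} P Q) = resp
    (λ x → solve 4 (λ a b c d → (a :- b) :+ (c :- d) := (a :+ c) :- (b :+ d)) refl
      (p (x [ i ]≔ true)) (p (x [ i ]≔ false)) (q (x [ i ]≔ true)) (q (x [ i ]≔ false)))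
    (plus (∂-degree i P) (∂-degree i Q))
  ∂-degree i (resp e P) = resp (λ x → cong₂ _-_ (e _) (e _)) (∂-degree i P)
  ∂-degree {d = d} i (times j {p = p} P) with j ≟ i
  ... | yes refl = resp
    (λ x → trans
      (solve 2 (λ a b → a :+ b := con 1ℚ :* a :- con (- 1ℚ) :* b) refl
        (p (x [ i ]≔ true)) (p (x [ i ]≔ false)))
      (sym (cong₂ (λ s t → val s * p (x [ i ]≔ true) - val t * p (x [ i ]≔ false))
        (lookup∘update i x true) (lookup∘update i x false))))
    (plus (restrict i true P) (restrict i false P))
  ... | no j≢i = resp
    (λ x → trans
      (solve 3 (λ v a b → v :* (a :- b) := v :* a :- v :* b) refl
        (val (lookup x j)) (p (x [ i ]≔ true)) (p (x [ i ]≔ false)))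
      (sym (cong₂ (λ s t → val s * p (x [ i ]≔ true) - val t * p (x [ i ]≔ false))
        (lookup∘update′ j≢i x true) (lookup∘update′ j≢i x false))))
    (val*∂ d P)
    where
    val*∂ : ∀ d → Degree≤ d p → Degree≤ d (λ x → val (lookup x j) * ∂ i p x)
    -- `times` cannot produce degree 0, but here `p` is constant and its derivative vanishes.
    val*∂ zero    P = resp (λ x → sym (trans
      (cong (val (lookup x j) *_)
        (trans (cong (_- p (x [ i ]≔ false)) (degree0-constant P _ _)) (+-inverseʳ (p (x [ i ]≔ false)))))
      (*-zeroʳ (val (lookup x j))))) (const 0ℚ)
    val*∂ (suc d) P = times j (∂-degree i P)

  powers : Vec ℕ n → Cube n → ℚ
  powers e x = foldr (λ _ → ℚ) _*_ 1ℚ (zipWith (λ b k → val b ^ℚ k) x e)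

  total : Vec ℕ n → ℕ
  total = foldr (λ _ → ℕ) ℕ._+_ 0

  times^ : ∀ i k {p : Cube n → ℚ} → Degree≤ d p → Degree≤ (k ℕ.+ d) (λ x → val (lookup x i) ^ℚ k * p x)
  times^ i zero    P = resp (λ _ → sym (*-identityˡ _)) P
  times^ i (suc k) {p} P = resp
    (λ x → sym (*-assoc (val (lookup x i)) (val (lookup x i) ^ℚ k) (p x)))
    (times i (times^ i k P))

  tail-affine : ∀ (i : Fin n) → ∃[ j ] AffineIn (λ z → val (lookup (tail z) i)) j
  tail-affine i = suc i , 0ℚ , 1ℚ , λ { (_ ∷ z) →
    solve 1 (λ v → v := con 0ℚ :+ con 1ℚ :* v) refl (val (lookup z i)) }

  powers-degree : ∀ (e : Vec ℕ n) → Degree≤ (total e) (powers e)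
  powers-degree []      = resp (λ { [] → refl }) (const 1ℚ)
  powers-degree (k ∷ e) = resp (λ { (_ ∷ _) → refl })
    (times^ zero k (substitute tail tail-affine (powers-degree e)))

  evalPoly-degree : ∀ {P : Polynomial n} → DegreeAtMost d P → Degree≤ d (evalPoly P)
  evalPoly-degree []                    = const 0ℚ
  evalPoly-degree {P = (c , e) ∷ _} (e≤d ∷ P≤d) =
    plus (weaken* (ℕ.≤⇒≤′ e≤d) (scale c (powers-degree e))) (evalPoly-degree P≤d)

  sgn-mono : ∀ s {a b} → a ≤ b → sgn s a ≡ true → sgn s b ≡ true
  sgn-mono s {a} {b} a≤b eq with 0ℚ <? b | 0ℚ <? a
  ... | yes _   | _       = refl
  ... | no  b≯0 | yes a>0 = ⊥-elim (b≯0 (<-≤-trans a>0 a≤b))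
  ... | no  b≯0 | no  _ with a <? 0ℚ | b <? 0ℚ
  ...   | no  a≮0 | yes b<0 = ⊥-elim (a≮0 (≤-<-trans a≤b b<0))
  ...   | no  _   | no  _   = eq

  sgn-pos : ∀ s {a} → 0ℚ < a → sgn s a ≡ true
  sgn-pos s {a} a>0 with 0ℚ <? a
  ... | yes _   = refl
  ... | no  a≯0 = ⊥-elim (a≯0 a>0)

  sgn-neg : ∀ s {a} → a < 0ℚ → sgn s a ≡ false
  sgn-neg s {a} a<0 with 0ℚ <? a
  ... | yes a>0 = ⊥-elim (<-asym a<0 a>0)
  ... | no  _ with a <? 0ℚ
  ...   | yes _   = refl
  ...   | no  a≮0 = ⊥-elim (a≮0 a<0)

  ind : Bool → ℚ
  ind true  = 1ℚ
  ind false = 0ℚ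

  sgn-separates : ∀ s a b → sgn s a ≡ true → sgn s b ≡ false → b < a
  sgn-separates s a b sa sb with b <? a
  ... | yes b<a = b<a
  ... | no  b≮a with trans (sym sb) (sgn-mono s (≮⇒≥ b≮a) sa)
  ...   | ()

  -- By monotonicity of `sgn`, different signs force a strict inequality between `a` and `b`. So
  -- `a - b` is nonzero and the convention at 0 does not interfere.
  sgn-difference : ∀ s a b → sgn s a ≢ sgn s b → sgn s (a - b) ≡ sgn s a
  sgn-difference s a b sa≢sb with sgn s a in sa | sgn s b in sb
  ... | true  | true  = ⊥-elim (sa≢sb refl)
  ... | false | false = ⊥-elim (sa≢sb refl)
  ... | true  | false = sgn-pos s
    (subst (_< a - b) (+-inverseʳ b) (+-monoˡ-< (- b) (sgn-separates s a b sa sb)))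
  ... | false | true  = sgn-neg s
    (subst (a - b <_) (+-inverseʳ b) (+-monoˡ-< (- b) (sgn-separates s b a sb sa)))

  -- Here `a` and `b` are the values at the two ends of an edge. If their signs agree, the terms on
  -- the right cancel; if not, `sgn-difference` makes each of them 1.
  differ-sgn : ∀ s a b →
    ind (differ (sgn s a) (sgn s b)) + ind (differ (sgn s b) (sgn s a)) ≡
    val (sgn s a) * (val true * val (sgn s (a - b))) + val (sgn s b) * (val false * val (sgn s (a - b)))
  differ-sgn s a b = pointwise (sgn s a) (sgn s b) (sgn s (a - b)) (sgn-difference s a b)
    where
    pointwise : ∀ u v w → (u ≢ v → w ≡ u) →
      ind (differ u v) + ind (differ v u) ≡ val u * (val true * val w) + val v * (val false * val w)
    pointwise true  true  true  _ = refl
    pointwise true  true  false _ = refl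
    pointwise false false true  _ = refl
    pointwise false false false _ = refl
    pointwise true  false w     h rewrite h (λ ()) = refl
    pointwise false true  w     h rewrite h (λ ()) = refl

  -- Influences and resampling

  2ℚ : ℚ
  2ℚ = 1ℚ + 1ℚ

  cube : ∀ n → Mean (Cube n)
  cube = vec bit

  pairs : ∀ n → Mean (Vec (Bool × Bool) n)
  pairs = vec (bit ⊗ bit)

  countWhere-++ : ∀ (q : A → Bool) as bs →
    countWhere q (as ++ bs) ≡ countWhere q as ℕ.+ countWhere q bs
  countWhere-++ q []       bs = refl
  countWhere-++ q (a ∷ as) bs with q a
  ... | true  = cong suc (countWhere-++ q as bs)
  ... | false = countWhere-++ q as bs

  countWhere-map : ∀ (q : B → Bool) (h : A → B) as →
    countWhere q (List.map h as) ≡ countWhere (q ∘ h) as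
  countWhere-map q h []       = refl
  countWhere-map q h (a ∷ as) with q (h a)
  ... | true  = cong suc (countWhere-map q h as)
  ... | false = countWhere-map q h as

  count-mean : ∀ n (q : Cube n → Bool) →
    ℕtoℚ (countWhere q (allPoints n)) * (½ ^ℚ n) ≡ E (cube n) (ind ∘ q)
  count-mean zero    q with q []
  ... | true  = refl
  ... | false = refl
  count-mean (suc n) q = begin
    ℕtoℚ (countWhere q (allPoints (suc n))) * (½ * ½ ^ℚ n)
      ≡⟨ cong (λ c → ℕtoℚ c * (½ * ½ ^ℚ n)) (trans
           (countWhere-++ q (List.map (true ∷_) (allPoints n)) _)
           (cong₂ ℕ._+_ (countWhere-map q _ (allPoints n)) (countWhere-map q _ (allPoints n)))) ⟩
    ℕtoℚ (t ℕ.+ u) * (½ * ½ ^ℚ n)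
      ≡⟨ cong (_* (½ * ½ ^ℚ n)) (ℕtoℚ-+ t u) ⟩
    (ℕtoℚ t + ℕtoℚ u) * (½ * ½ ^ℚ n)
      ≡⟨ solve 3 (λ a b h → (a :+ b) :* (con ½ :* h) := con ½ :* (a :* h :+ b :* h)) refl
           (ℕtoℚ t) (ℕtoℚ u) (½ ^ℚ n) ⟩
    ½ * (ℕtoℚ t * ½ ^ℚ n + ℕtoℚ u * ½ ^ℚ n)
      ≡⟨ cong₂ (λ a b → ½ * (a + b)) (count-mean n (q ∘ (true ∷_))) (count-mean n (q ∘ (false ∷_))) ⟩
    E (cube (suc n)) (ind ∘ q) ∎
    where
    open ≡-Reasoning
    t = countWhere (q ∘ (true ∷_)) (allPoints n)
    u = countWhere (q ∘ (false ∷_)) (allPoints n)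

  influence-mean : ∀ (f : Cube n → Bool) i →
    influence f i ≡ E (cube n) (λ x → ind (differ (f x) (f (flipAt i x))))
  influence-mean {n} f i = count-mean n (λ x → differ (f x) (f (flipAt i x)))

  flipAt-≔ : ∀ (x : Cube n) i b → flipAt i (x [ i ]≔ b) ≡ x [ i ]≔ not b
  flipAt-≔ (_ ∷ x) zero    b = refl
  flipAt-≔ (a ∷ x) (suc i) b = cong (a ∷_) (flipAt-≔ x i b)

  ∂-≔ : ∀ (i : Fin n) p x b → ∂ i p (x [ i ]≔ b) ≡ ∂ i p x
  ∂-≔ i p x b = cong₂ _-_ (cong p ([]≔-idempotent x i)) (cong p ([]≔-idempotent x i))

  -- Averaging over coordinate `i` first pairs the two ends of each edge in that direction. The
  -- derivative is constant on such an edge, so `differ-sgn` applies edge by edge.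
  influence-sgn : ∀ s (p : Cube n → ℚ) i → influence (sgn s ∘ p) i ≡
    E (cube n) (λ x → val (sgn s (p x)) * (val (lookup x i) * val (sgn s (∂ i p x))))
  influence-sgn {n} s p i = begin
    influence (sgn s ∘ p) i                ≡⟨ influence-mean (sgn s ∘ p) i ⟩
    E (cube n) F                           ≡⟨ E-resample bit i F ⟩
    E (cube n) (λ x → E bit (λ a → F (x [ i ]≔ a))) ≡⟨ E-cong (cube n) pointwise ⟩
    E (cube n) (λ x → E bit (λ a → G (x [ i ]≔ a))) ≡⟨ E-resample bit i G ⟨
    E (cube n) G ∎
    where
    open ≡-Reasoning
    F G : Cube n → ℚ
    F x = ind (differ (sgn s (p x)) (sgn s (p (flipAt i x))))
    G x = val (sgn s (p x)) * (val (lookup x i) * val (sgn s (∂ i p x)))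

    F-≔ : ∀ x b → F (x [ i ]≔ b) ≡ ind (differ (sgn s (p (x [ i ]≔ b))) (sgn s (p (x [ i ]≔ not b))))
    F-≔ x b = cong (λ y → ind (differ (sgn s (p (x [ i ]≔ b))) (sgn s (p y)))) (flipAt-≔ x i b)

    G-≔ : ∀ x b → G (x [ i ]≔ b) ≡ val (sgn s (p (x [ i ]≔ b))) * (val b * val (sgn s (∂ i p x)))
    G-≔ x b = cong₂ (λ c q → val (sgn s (p (x [ i ]≔ b))) * (val c * val (sgn s q)))
      (lookup∘update i x b) (∂-≔ i p x b)

    pointwise : ∀ x → E bit (λ a → F (x [ i ]≔ a)) ≡ E bit (λ a → G (x [ i ]≔ a))
    pointwise x = cong (½ *_) (begin
      F (x [ i ]≔ true) + F (x [ i ]≔ false) ≡⟨ cong₂ _+_ (F-≔ x true) (F-≔ x false) ⟩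
      _                                      ≡⟨ differ-sgn s (p (x [ i ]≔ true)) (p (x [ i ]≔ false)) ⟩
      _                                      ≡⟨ cong₂ _+_ (G-≔ x true) (G-≔ x false) ⟨
      G (x [ i ]≔ true) + G (x [ i ]≔ false) ∎)

  original : Vec (Bool × Bool) n → Cube n
  original = map proj₁

  resampleBlock : Fin k → Vec (Fin k) n → Vec (Bool × Bool) n → Cube n
  resampleBlock j = zipWith λ c (a , a′) → if ⌊ c ≟ j ⌋ then a′ else a

  select : Vec (Fin k) n → Vec (Bool × Bool) n → Cube k → Cube n
  select b u z = zipWith (λ c (a , a′) → if lookup z c then a else a′) b u

  swapUnless : Cube k → Fin k → Bool × Bool → Bool × Bool
  swapUnless z c = if lookup z c then id else swap

  -- The two copies are independent with the same law, hence exchangeable.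
  swapUnless-preserves : ∀ (z : Cube k) c F → E (bit ⊗ bit) (F ∘ swapUnless z c) ≡ E (bit ⊗ bit) F
  swapUnless-preserves z c F with lookup z c
  ... | true  = refl
  ... | false = sym (fubini bit (linear bit) λ a b → F (a , b))

  original-swap : ∀ (b : Vec (Fin k) n) u z → original (zipWith (swapUnless z) b u) ≡ select b u z
  original-swap []      []            z = refl
  original-swap (c ∷ b) ((a , a′) ∷ u) z = cong₂ _∷_ head-eq (original-swap b u z)
    where
    head-eq : proj₁ (swapUnless z c (a , a′)) ≡ (if lookup z c then a else a′)
    head-eq with lookup z c
    ... | true  = refl
    ... | false = refl

  -- On block `j` the resampled point reads the copy that `z` did not choose, which is what flipping
  -- the selector bit `j` does.
  resampleBlock-swap : ∀ j (b : Vec (Fin k) n) u z →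
    resampleBlock j b (zipWith (swapUnless z) b u) ≡ select b u (flipAt j z)
  resampleBlock-swap j []      []            z = refl
  resampleBlock-swap j (c ∷ b) ((a , a′) ∷ u) z = cong₂ _∷_ head-eq (resampleBlock-swap j b u z)
    where
    head-eq : (if ⌊ c ≟ j ⌋ then proj₂ (swapUnless z c (a , a′)) else proj₁ (swapUnless z c (a , a′)))
            ≡ (if lookup (flipAt j z) c then a else a′)
    head-eq with c ≟ j
    head-eq | yes refl rewrite lookup∘updateAt c {not} z with lookup z c
    ... | true  = refl
    ... | false = refl
    head-eq | no c≢j rewrite lookup∘updateAt′ c j {not} c≢j z with lookup z c
    ... | true  = refl
    ... | false = refl

  -- For each fixed `z`, swapping copies according to `z` preserves the law of `u` and turns the
  -- original and the resampled point into the selections at `z` and at its neighbour in direction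
  -- `j`. A dummy average over `z` then produces the influence of `j` on a function of `k` bits.
  resampled-sensitivity : ∀ (h : Cube n → Bool) (b : Vec (Fin k) n) →
    sumFin k (λ j → E (pairs n) (λ u → ind (differ (h (original u)) (h (resampleBlock j b u)))))
      ≡ E (pairs n) (λ u → averageSensitivity (h ∘ select b u))
  resampled-sensitivity {n} {k} h b = begin
    sumFin k (λ j → E (pairs n) (F j))
      ≡⟨ L-cong (sumFin-linear k) (λ j → sym (E-const (cube k) (E (pairs n) (F j)))) ⟩
    sumFin k (λ j → E (cube k) (λ z → E (pairs n) (F j)))
      ≡⟨ L-cong (sumFin-linear k) (λ j → E-cong (cube k) (λ z → swapped j z)) ⟩
    sumFin k (λ j → E (cube k) (λ z → E (pairs n) (λ u → G u j z)))
      ≡⟨ L-cong (sumFin-linear k) (λ j → fubini (pairs n) (linear (cube k)) (λ z u → G u j z)) ⟩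
    sumFin k (λ j → E (pairs n) (λ u → E (cube k) (G u j)))
      ≡⟨ fubini (pairs n) (sumFin-linear k) (λ j u → E (cube k) (G u j)) ⟩
    E (pairs n) (λ u → sumFin k (λ j → E (cube k) (G u j)))
      ≡⟨ E-cong (pairs n) (λ u → L-cong (sumFin-linear k) λ j → sym (influence-mean (h ∘ select b u) j)) ⟩
    E (pairs n) (λ u → averageSensitivity (h ∘ select b u)) ∎
    where
    open ≡-Reasoning
    F : Fin k → Vec (Bool × Bool) n → ℚ
    F j u = ind (differ (h (original u)) (h (resampleBlock j b u)))
    G : Vec (Bool × Bool) n → Fin k → Cube k → ℚ
    G u j z = ind (differ (h (select b u z)) (h (select b u (flipAt j z))))

    swapped : ∀ j z → E (pairs n) (F j) ≡ E (pairs n) (λ u → G u j z)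
    swapped j z = trans
      (sym (E-zipWith (bit ⊗ bit) (swapUnless z) (swapUnless-preserves z) b (F j)))
      (E-cong (pairs n) λ u → cong₂ (λ x y → ind (differ (h x) (h y)))
        (original-swap b u z) (resampleBlock-swap j b u z))

  -- Linear interpolation between the two copies in the selector bit: this keeps the degree when
  -- passing from `n` variables to `k`.
  select-affine : ∀ (b : Vec (Fin k) n) u i → ∃[ j ] AffineIn (λ z → val (lookup (select b u z) i)) j
  select-affine (c ∷ b) ((a , a′) ∷ u) zero = c , ½ * (val a + val a′) , ½ * (val a - val a′) , eq
    where
    eq : ∀ z → val (if lookup z c then a else a′) ≡
         ½ * (val a + val a′) + ½ * (val a - val a′) * val (lookup z c)
    eq z with lookup z c
    ... | true  = solve 2 (λ a b → a := con ½ :* (a :+ b) :+ con ½ :* (a :- b) :* con 1ℚ) refl (val a) (val a′)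
    ... | false = solve 2 (λ a b → b := con ½ :* (a :+ b) :+ con ½ :* (a :- b) :* con (- 1ℚ)) refl (val a) (val a′)
  select-affine (c ∷ b) (_ ∷ u) (suc i) = select-affine b u i

  -- The recursion in the degree

  sumFin-double : ∀ m n (F : Fin m → Fin n → ℚ) →
    sumFin m (λ i → sumFin n (F i)) ≡ sumFin n (λ j → sumFin m (λ i → F i j))
  sumFin-double m n F = L-sumFin (sumFin-linear m) n F

  δ : Fin k → Fin k → ℚ
  δ c j = ind ⌊ c ≟ j ⌋

  δ-suc : ∀ (c j : Fin k) → δ (suc c) (suc j) ≡ δ c j
  δ-suc c j with c ≟ j
  ... | yes _ = refl
  ... | no  _ = refl

  sumFin-δ : ∀ (c : Fin k) (t : Fin k → ℚ) → sumFin k (λ j → δ c j * t j) ≡ t c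
  sumFin-δ {suc k} zero t = begin
    1ℚ * t zero + sumFin k (λ j → 0ℚ * t (suc j))
      ≡⟨ cong (1ℚ * t zero +_) (L-* (sumFin-linear k) 0ℚ (t ∘ suc)) ⟩
    1ℚ * t zero + 0ℚ * sumFin k (t ∘ suc)
      ≡⟨ solve 2 (λ a b → con 1ℚ :* a :+ con 0ℚ :* b := a) refl (t zero) (sumFin k (t ∘ suc)) ⟩
    t zero ∎
    where open ≡-Reasoning
  sumFin-δ {suc k} (suc c) t = begin
    0ℚ * t zero + sumFin k (λ j → δ (suc c) (suc j) * t (suc j))
      ≡⟨ cong₂ _+_ (*-zeroˡ (t zero))
           (L-cong (sumFin-linear k) λ j → cong (_* t (suc j)) (δ-suc c j)) ⟩
    0ℚ + sumFin k (λ j → δ c j * t (suc j))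
      ≡⟨ +-identityˡ _ ⟩
    sumFin k (λ j → δ c j * t (suc j))
      ≡⟨ sumFin-δ c (t ∘ suc) ⟩
    t (suc c) ∎
    where open ≡-Reasoning

  sumFin-δ-1 : ∀ (c : Fin k) → sumFin k (δ c) ≡ 1ℚ
  sumFin-δ-1 {k} c = trans (L-cong (sumFin-linear k) λ j → sym (*-identityʳ (δ c j))) (sumFin-δ c (λ _ → 1ℚ))

  -- Pythagoras: expand the square and use orthogonality to remove the cross terms.
  E-square-sum : ∀ (μ : Mean A) n (y : Fin n → A → ℚ) →
    (∀ i j → i ≢ j → E μ (λ x → y i x * y j x) ≡ 0ℚ) →
    E μ (λ x → sumFin n (λ i → y i x) * sumFin n (λ i → y i x)) ≡
    sumFin n (λ i → E μ (λ x → y i x * y i x))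
  E-square-sum μ zero    y orth = E-const μ 0ℚ
  E-square-sum μ (suc n) y orth = begin
    E μ (λ x → (y₀ x + S x) * (y₀ x + S x))
      ≡⟨ E-cong μ (λ x → solve 2 (λ a b → (a :+ b) :* (a :+ b) :=
           (a :* a :+ b :* b) :+ con 2ℚ :* (a :* b)) refl (y₀ x) (S x)) ⟩
    E μ (λ x → (y₀ x * y₀ x + S x * S x) + 2ℚ * (y₀ x * S x))
      ≡⟨ L-+ (linear μ) _ _ ⟩
    E μ (λ x → y₀ x * y₀ x + S x * S x) + E μ (λ x → 2ℚ * (y₀ x * S x))
      ≡⟨ cong₂ _+_ (L-+ (linear μ) _ _) (trans (L-* (linear μ) 2ℚ _) (cong (2ℚ *_) cross)) ⟩
    (E μ (λ x → y₀ x * y₀ x) + E μ (λ x → S x * S x)) + 2ℚ * 0ℚ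
      ≡⟨ +-identityʳ _ ⟩
    E μ (λ x → y₀ x * y₀ x) + E μ (λ x → S x * S x)
      ≡⟨ cong (E μ (λ x → y₀ x * y₀ x) +_)
           (E-square-sum μ n (y ∘ suc) λ i j i≢j → orth (suc i) (suc j) λ { refl → i≢j refl }) ⟩
    _ ∎
    where
    open ≡-Reasoning
    y₀ S : _ → ℚ
    y₀ = y zero
    S x = sumFin n (λ i → y (suc i) x)

    cross : E μ (λ x → y₀ x * S x) ≡ 0ℚ
    cross = begin
      E μ (λ x → y₀ x * S x)
        ≡⟨ E-cong μ (λ x → sym (L-* (sumFin-linear n) (y₀ x) _)) ⟩
      E μ (λ x → sumFin n (λ i → y₀ x * y (suc i) x))
        ≡⟨ L-sumFin (linear μ) n _ ⟩
      sumFin n (λ i → E μ (λ x → y₀ x * y (suc i) x))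
        ≡⟨ L-cong (sumFin-linear n) (λ i → orth zero (suc i) λ ()) ⟩
      sumFin n (λ _ → 0ℚ)
        ≡⟨ L-0 (sumFin-linear n) ⟩
      0ℚ ∎

  val² : ∀ a → val a * val a ≡ 1ℚ
  val² true  = refl
  val² false = refl

  zipWith-≔ : ∀ {A B C : Set} (f : A → B → C) (as : Vec A n) (bs : Vec B n) i b →
    zipWith f as (bs [ i ]≔ b) ≡ zipWith f as bs [ i ]≔ f (lookup as i) b
  zipWith-≔ f (a ∷ as) (_ ∷ bs) zero    b = refl
  zipWith-≔ f (a ∷ as) (_ ∷ bs) (suc i) b = cong (_ ∷_) (zipWith-≔ f as bs i b)

  ≔-zipWith : ∀ {A B C : Set} (f : A → B → C) (as : Vec A n) (bs : Vec B n) i a →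
    zipWith f (as [ i ]≔ a) bs ≡ zipWith f as bs [ i ]≔ f a (lookup bs i)
  ≔-zipWith f (_ ∷ as) (b ∷ bs) zero    a = refl
  ≔-zipWith f (_ ∷ as) (b ∷ bs) (suc i) a = cong (_ ∷_) (≔-zipWith f as bs i a)

  E-original : ∀ (F : Cube n → ℚ) → E (pairs n) (F ∘ original) ≡ E (cube n) F
  E-original {n} = E-map (bit ⊗ bit) bit proj₁ (λ F → E-cong bit λ a → E-const bit (F a)) n

  -- Two products of signs that differ in one factor are at distance at most 2.
  replace : ∀ f x g g′ → val f * (val x * val g) ≤ val f * (val x * val g′) + 2ℚ * ind (differ g g′)
  replace f x true  true  = ≤-reflexive (sym (+-identityʳ _))
  replace f x false false = ≤-reflexive (sym (+-identityʳ _))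
  replace true  true  true  false = ≤ᵇ⇒≤ _
  replace true  false true  false = ≤ᵇ⇒≤ _
  replace false true  true  false = ≤ᵇ⇒≤ _
  replace false false true  false = ≤ᵇ⇒≤ _
  replace true  true  false true  = ≤ᵇ⇒≤ _
  replace true  false false true  = ≤ᵇ⇒≤ _
  replace false true  false true  = ≤ᵇ⇒≤ _
  replace false false false true  = ≤ᵇ⇒≤ _

  square-nonNeg : ∀ a → 0ℚ ≤ a * a
  square-nonNeg a with ≤-total 0ℚ a
  ... | inj₁ 0≤a = subst (_≤ a * a) (*-zeroʳ a) (*-monoˡ-≤-nonNeg a {{nonNegative 0≤a}} 0≤a)
  ... | inj₂ a≤0 = subst (_≤ a * a) (*-zeroʳ a) (*-monoˡ-≤-nonPos a {{nonPositive a≤0}} a≤0)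

  -- From ρ (Y − f r)² ≥ 0.
  am-gm : ∀ {ρ r} → 0ℚ ≤ ρ → ρ * r ≡ 1ℚ → ∀ f Y → val f * Y ≤ ½ * (ρ * (Y * Y) + r)
  am-gm {ρ} {r} 0≤ρ ρr≡1 f Y = begin
    val f * Y
      ≡⟨ +-identityʳ _ ⟨
    val f * Y + 0ℚ
      ≤⟨ +-monoʳ-≤ (val f * Y) nonneg ⟩
    val f * Y + ½ * (ρ * ((Y - val f * r) * (Y - val f * r)))
      ≡⟨ solve 4 (λ v Y ρ r → v :* Y :+ con ½ :* (ρ :* ((Y :- v :* r) :* (Y :- v :* r))) :=
           v :* Y :* (con 1ℚ :- ρ :* r) :+ con ½ :* (ρ :* (Y :* Y) :+ (v :* v) :* ((ρ :* r) :* r)))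
           refl (val f) Y ρ r ⟩
    val f * Y * (1ℚ - ρ * r) + ½ * (ρ * (Y * Y) + (val f * val f) * ((ρ * r) * r))
      ≡⟨ cong₂ (λ a b → val f * Y * (1ℚ - a) + ½ * (ρ * (Y * Y) + b * (a * r))) ρr≡1 (val² f) ⟩
    val f * Y * (1ℚ - 1ℚ) + ½ * (ρ * (Y * Y) + 1ℚ * (1ℚ * r))
      ≡⟨ solve 3 (λ a b r → a :* (con 1ℚ :- con 1ℚ) :+ con ½ :* (b :+ con 1ℚ :* (con 1ℚ :* r)) :=
           con ½ :* (b :+ r)) refl (val f * Y) (ρ * (Y * Y)) r ⟩
    ½ * (ρ * (Y * Y) + r) ∎
    where
    open ≤-Reasoning
    nonneg : 0ℚ ≤ ½ * (ρ * ((Y - val f * r) * (Y - val f * r)))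
    nonneg = *-monoˡ-≤-nonNeg ½ (subst (_≤ ρ * _) (*-zeroʳ ρ)
      (*-monoˡ-≤-nonNeg ρ {{nonNegative 0≤ρ}} (square-nonNeg (Y - val f * r))))

  -- One step of the recursion for a fixed colouring

  module Step (s : Bool) {n k : ℕ} (p : Cube n → ℚ) where

    f : Cube n → Bool
    f = sgn s ∘ p

    g : Fin n → Cube n → Bool
    g i = sgn s ∘ ∂ i p

    g-≔ : ∀ i x b → g i (x [ i ]≔ b) ≡ g i x
    g-≔ i x b = cong (sgn s) (∂-≔ i p x b)

    module Blocks (b : Vec (Fin k) n) where

      t : Fin n → Fin k → Vec (Bool × Bool) n → ℚ
      t i j u = val (lookup (original u) i) * val (g i (resampleBlock j b u))

      -- The indicator cuts the terms down to block `j`, so that sums range over all of `Fin n`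
      -- instead of over a subset.
      y : Fin k → Fin n → Vec (Bool × Bool) n → ℚ
      y j i u = δ (lookup b i) j * t i j u

      Y : Fin k → Vec (Bool × Bool) n → ℚ
      Y j u = sumFin n (λ i → y j i u)

      ΣY : ∀ u → sumFin k (λ j → Y j u) ≡ sumFin n (λ i → t i (lookup b i) u)
      ΣY u = trans (sumFin-double k n (λ j i → y j i u))
        (L-cong (sumFin-linear n) λ i → sumFin-δ (lookup b i) (λ j → t i j u))

      y² : ∀ j i u → y j i u * y j i u ≡ δ (lookup b i) j
      y² j i u = begin
        δ c j * (v * w) * (δ c j * (v * w))
          ≡⟨ solve 3 (λ d v w → d :* (v :* w) :* (d :* (v :* w)) := (d :* d) :* ((v :* v) :* (w :* w)))
               refl (δ c j) v w ⟩
        (δ c j * δ c j) * ((v * v) * (w * w))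
          ≡⟨ cong₂ _*_ (δ² (⌊ c ≟ j ⌋)) (cong₂ _*_ (val² (lookup (original u) i)) (val² (g i (resampleBlock j b u)))) ⟩
        δ c j * 1ℚ
          ≡⟨ *-identityʳ (δ c j) ⟩
        δ c j ∎
        where
        open ≡-Reasoning
        c = lookup b i
        v = val (lookup (original u) i)
        w = val (g i (resampleBlock j b u))
        δ² : ∀ e → ind e * ind e ≡ ind e
        δ² true  = refl
        δ² false = refl

      -- Inside block `j` only the second copy is read, so the first component of `a` leaves no
      -- trace.
      resampleBlock-≔ : ∀ j u i a → lookup b i ≡ j →
        resampleBlock j b (u [ i ]≔ a) ≡ resampleBlock j b u [ i ]≔ proj₂ a
      resampleBlock-≔ j u i a refl = trans (zipWith-≔ _ b u i a) (cong (resampleBlock j b u [ i ]≔_) in-block)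
        where
        in-block : (if ⌊ lookup b i ≟ lookup b i ⌋ then proj₂ a else proj₁ a) ≡ proj₂ a
        in-block with lookup b i ≟ lookup b i
        ... | yes _ = refl
        ... | no ≢  = ⊥-elim (≢ refl)

      -- Within a block, x_i is independent of everything else in the product: after
      -- resampling, the g's see only the second copy.
      orthogonal : ∀ j i i′ → i ≢ i′ → E (pairs n) (λ u → y j i u * y j i′ u) ≡ 0ℚ
      orthogonal j i i′ i≢i′ with lookup b i ≟ j
      ... | no  _   = trans
        (E-cong (pairs n) λ u → solve 2 (λ v w → con 0ℚ :* v :* w := con 0ℚ) refl (t i j u) (y j i′ u))
        (E-const (pairs n) 0ℚ)
      ... | yes bi≡j = begin
        E (pairs n) F                                                     ≡⟨ E-resample (bit ⊗ bit) i F ⟩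
        E (pairs n) (λ u → E (bit ⊗ bit) (λ a → F (u [ i ]≔ a)))          ≡⟨ E-cong (pairs n) vanish ⟩
        E (pairs n) (λ _ → 0ℚ)                                            ≡⟨ E-const (pairs n) 0ℚ ⟩
        0ℚ ∎
        where
        open ≡-Reasoning
        F : Vec (Bool × Bool) n → ℚ
        F u = 1ℚ * t i j u * y j i′ u

        K : Vec (Bool × Bool) n → Bool → ℚ
        K u a′ = val (g i x) * (δ (lookup b i′) j * (val (lookup (original u) i′) * val (g i′ x)))
          where x = resampleBlock j b u [ i ]≔ a′

        product : Bool → Bool → Cube n → ℚ
        product v v′ x =
          1ℚ * (val v * val (g i x)) * (δ (lookup b i′) j * (val v′ * val (g i′ x)))

        F-≔ : ∀ u a → F (u [ i ]≔ a) ≡ val (proj₁ a) * K u (proj₂ a)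
        F-≔ u a = begin
          product (lookup (original (u [ i ]≔ a)) i) (lookup (original (u [ i ]≔ a)) i′)
                  (resampleBlock j b (u [ i ]≔ a))
            ≡⟨ cong (product (lookup (original (u [ i ]≔ a)) i) (lookup (original (u [ i ]≔ a)) i′))
                 (resampleBlock-≔ j u i a bi≡j) ⟩
          product (lookup (original (u [ i ]≔ a)) i) (lookup (original (u [ i ]≔ a)) i′) x
            ≡⟨ cong (λ v → product (lookup v i) (lookup v i′) x) (map-[]≔ proj₁ u i) ⟩
          product (lookup (original u [ i ]≔ proj₁ a) i) (lookup (original u [ i ]≔ proj₁ a) i′) x
            ≡⟨ cong₂ (λ v v′ → product v v′ x) (lookup∘update i (original u) (proj₁ a))
                 (lookup∘update′ (i≢i′ ∘ sym) (original u) (proj₁ a)) ⟩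
          product (proj₁ a) (lookup (original u) i′) x
            ≡⟨ solve 3 (λ v w z → con 1ℚ :* (v :* w) :* z := v :* (w :* z)) refl
                 (val (proj₁ a)) (val (g i x))
                 (δ (lookup b i′) j * (val (lookup (original u) i′) * val (g i′ x))) ⟩
          val (proj₁ a) * K u (proj₂ a) ∎
          where x = resampleBlock j b u [ i ]≔ proj₂ a

        vanish : ∀ u → E (bit ⊗ bit) (λ a → F (u [ i ]≔ a)) ≡ 0ℚ
        vanish u = trans (E-cong (bit ⊗ bit) (F-≔ u))
          (solve 2 (λ s t → con ½ :* (con ½ :* (con 1ℚ :* s :+ con 1ℚ :* t)
              :+ con ½ :* (con (- 1ℚ) :* s :+ con (- 1ℚ) :* t)) := con 0ℚ) refl (K u true) (K u false))

      -- Orthogonality leaves the diagonal, and each `y` is a sign on the block and 0 off it; the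
      -- value is the size of block `j`.
      E-Y² : ∀ j → E (pairs n) (λ u → Y j u * Y j u) ≡ sumFin n (λ i → δ (lookup b i) j)
      E-Y² j = trans (E-square-sum (pairs n) n (y j) (orthogonal j))
        (L-cong (sumFin-linear n) λ i → trans (E-cong (pairs n) (y² j i)) (E-const (pairs n) _))

      error : Fin n → Fin k → ℚ
      error i j = E (pairs n) (λ u → ind (differ (g i (original u)) (g i (resampleBlock j b u))))

      -- Group the terms by block and apply `am-gm` to each block sum, in place of Cauchy-Schwarz.
      -- The second moments are the block sizes, which add up to `n` because the blocks partition
      -- the coordinates; each of the `k` blocks contributes one further `r`.
      frozen-bound : ∀ {ρ r} → 0ℚ ≤ ρ → ρ * r ≡ 1ℚ →
        sumFin n (λ i → E (pairs n) (λ u → val (f (original u)) * t i (lookup b i) u))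
          ≤ ½ * (ρ * ℕtoℚ n + ℕtoℚ k * r)
      frozen-bound {ρ} {r} 0≤ρ ρr≡1 = begin
        sumFin n (λ i → E (pairs n) (λ u → val (f (original u)) * t i (lookup b i) u))
          ≡⟨ L-sumFin (linear (pairs n)) n _ ⟨
        E (pairs n) (λ u → sumFin n (λ i → val (f (original u)) * t i (lookup b i) u))
          ≡⟨ E-cong (pairs n) (λ u → trans (L-* (sumFin-linear n) (val (f (original u))) _)
               (cong (val (f (original u)) *_) (sym (ΣY u)))) ⟩
        E (pairs n) (λ u → val (f (original u)) * sumFin k (λ j → Y j u))
          ≡⟨ E-cong (pairs n) (λ u → sym (L-* (sumFin-linear k) (val (f (original u))) _)) ⟩
        E (pairs n) (λ u → sumFin k (λ j → val (f (original u)) * Y j u))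
          ≡⟨ L-sumFin (linear (pairs n)) k _ ⟩
        sumFin k (λ j → E (pairs n) (λ u → val (f (original u)) * Y j u))
          ≤⟨ sumFin-mono k (λ j → E-mono (pairs n) (λ u → am-gm 0≤ρ ρr≡1 (f (original u)) (Y j u))) ⟩
        sumFin k (λ j → E (pairs n) (λ u → ½ * (ρ * (Y j u * Y j u) + r)))
          ≡⟨ L-cong (sumFin-linear k) (λ j → begin-equality
               E (pairs n) (λ u → ½ * (ρ * (Y j u * Y j u) + r))
                 ≡⟨ L-* (linear (pairs n)) ½ _ ⟩
               ½ * E (pairs n) (λ u → ρ * (Y j u * Y j u) + r)
                 ≡⟨ cong (½ *_) (L-+ (linear (pairs n)) _ _) ⟩
               ½ * (E (pairs n) (λ u → ρ * (Y j u * Y j u)) + E (pairs n) (λ _ → r))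
                 ≡⟨ cong₂ (λ a b → ½ * (a + b))
                      (trans (L-* (linear (pairs n)) ρ _) (cong (ρ *_) (E-Y² j))) (E-const (pairs n) r) ⟩
               ½ * (ρ * sumFin n (λ i → δ (lookup b i) j) + r) ∎) ⟩
        sumFin k (λ j → ½ * (ρ * sumFin n (λ i → δ (lookup b i) j) + r))
          ≡⟨ L-* (sumFin-linear k) ½ _ ⟩
        ½ * sumFin k (λ j → ρ * sumFin n (λ i → δ (lookup b i) j) + r)
          ≡⟨ cong (½ *_) (L-+ (sumFin-linear k) _ _) ⟩
        ½ * (sumFin k (λ j → ρ * sumFin n (λ i → δ (lookup b i) j)) + sumFin k (λ _ → r))
          ≡⟨ cong₂ (λ a b → ½ * (a + b)) (L-* (sumFin-linear k) ρ _) (sumFin-const k r) ⟩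
        ½ * (ρ * sumFin k (λ j → sumFin n (λ i → δ (lookup b i) j)) + ℕtoℚ k * r)
          ≡⟨ cong (λ a → ½ * (ρ * a + ℕtoℚ k * r)) sizes ⟩
        ½ * (ρ * ℕtoℚ n + ℕtoℚ k * r) ∎
        where
        open ≤-Reasoning
        sizes : sumFin k (λ j → sumFin n (λ i → δ (lookup b i) j)) ≡ ℕtoℚ n
        sizes = trans (sumFin-double k n _)
          (trans (L-cong (sumFin-linear n) λ i → sumFin-δ-1 (lookup b i))
          (trans (sumFin-const n 1ℚ) (*-identityʳ (ℕtoℚ n))))

      influence-bound : ∀ i → influence f i ≤
        E (pairs n) (λ u → val (f (original u)) * t i (lookup b i) u) + 2ℚ * error i (lookup b i)
      influence-bound i = begin
        influence f i
          ≡⟨ influence-sgn s p i ⟩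
        E (cube n) (λ x → val (f x) * (val (lookup x i) * val (g i x)))
          ≡⟨ E-original (λ x → val (f x) * (val (lookup x i) * val (g i x))) ⟨
        E (pairs n) (λ u → val (f (original u)) * (val (lookup (original u) i) * val (g i (original u))))
          ≤⟨ E-mono (pairs n) (λ u → replace (f (original u)) (lookup (original u) i)
               (g i (original u)) (g i (resampleBlock (lookup b i) b u))) ⟩
        E (pairs n) (λ u → val (f (original u)) * t i (lookup b i) u
          + 2ℚ * ind (differ (g i (original u)) (g i (resampleBlock (lookup b i) b u))))
          ≡⟨ L-+ (linear (pairs n)) _ _ ⟩
        _ ≡⟨ cong (E (pairs n) (λ u → val (f (original u)) * t i (lookup b i) u) +_)
               (L-* (linear (pairs n)) 2ℚ _) ⟩
        _ ∎
        where open ≤-Reasoning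

      partition-bound : ∀ {ρ r} → 0ℚ ≤ ρ → ρ * r ≡ 1ℚ →
        averageSensitivity f ≤
          ½ * (ρ * ℕtoℚ n + ℕtoℚ k * r) + 2ℚ * sumFin n (λ i → error i (lookup b i))
      partition-bound {ρ} {r} 0≤ρ ρr≡1 = begin
        sumFin n (influence f)
          ≤⟨ sumFin-mono n influence-bound ⟩
        sumFin n (λ i → E (pairs n) (λ u → val (f (original u)) * t i (lookup b i) u) + 2ℚ * error i (lookup b i))
          ≡⟨ L-+ (sumFin-linear n) _ _ ⟩
        _ ≡⟨ cong (sumFin n (λ i → E (pairs n) (λ u → val (f (original u)) * t i (lookup b i) u)) +_)
               (L-* (sumFin-linear n) 2ℚ (λ i → error i (lookup b i))) ⟩
        _ ≤⟨ +-monoˡ-≤ (2ℚ * sumFin n (λ i → error i (lookup b i))) (frozen-bound 0≤ρ ρr≡1) ⟩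
        _ ∎
        where open ≤-Reasoning

  recolour : ∀ j (b : Vec (Fin k) n) u i a →
    ∃[ c ] resampleBlock j (b [ i ]≔ a) u ≡ resampleBlock j b u [ i ]≔ c
  recolour j b u i a = _ , ≔-zipWith _ b u i a

  -- Averaging over random colourings

  module _ (s : Bool) {n k d : ℕ} {p : Cube n → ℚ} (P : Degree≤ (suc d) p) {α : ℚ}
    (ih : ∀ {q : Cube (suc k) → ℚ} → Degree≤ d q → averageSensitivity (sgn s ∘ q) ≤ α * ℕtoℚ (suc k))
    where

    open Step s {n} {suc k} p
    open Blocks using (error; partition-bound)

    private
      colours : Mean (Vec (Fin (suc k)) n)
      colours = vec (fin k) n

    -- Recolouring `i` can alter the resampled point only at coordinate `i`, and `g i` ignores that
    -- coordinate.
    error-recolour : ∀ b i a j → error (b [ i ]≔ a) i j ≡ error b i j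
    error-recolour b i a j = E-cong (pairs n) λ u → cong (λ y → ind (differ (g i (original u)) y))
      (trans (cong (g i) (proj₂ (recolour j b u i a))) (g-≔ i (resampleBlock j b u) _))

    -- Summed over the blocks, the errors are the mean average sensitivity of `g i` restricted to
    -- selector bits. That is the sign of a polynomial of degree at most `d` in `suc k` variables,
    -- so `ih` applies for every `u`.
    error-mean : ∀ b i → E (fin k) (error b i) ≤ α
    error-mean b i = begin
      recip k * sumFin (suc k) (error b i)
        ≡⟨ cong (recip k *_) (resampled-sensitivity (g i) b) ⟩
      recip k * E (pairs n) (λ u → averageSensitivity (g i ∘ select b u))
        ≤⟨ *-monoˡ-≤-nonNeg (recip k) {{pos⇒nonNeg (recip k) {{recip-pos k}}}}
             (E-mono (pairs n) λ u → ih (substitute (select b u) (select-affine b u) (∂-degree i P))) ⟩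
      recip k * E (pairs n) (λ _ → α * ℕtoℚ (suc k))
        ≡⟨ cong (recip k *_) (E-const (pairs n) (α * ℕtoℚ (suc k))) ⟩
      recip k * (α * ℕtoℚ (suc k))
        ≡⟨ solve 3 (λ a b c → a :* (b :* c) := (a :* c) :* b) refl (recip k) α (ℕtoℚ (suc k)) ⟩
      recip k * ℕtoℚ (suc k) * α
        ≡⟨ trans (cong (_* α) (recip-* k)) (*-identityˡ α) ⟩
      α ∎
      where open ≤-Reasoning

    -- The colour of `i` is uniform and independent of the other colours, and by `error-recolour`
    -- the error depends on the colouring only through those others. So the block of `i` may be
    -- treated as an independent random block.
    error-own-block : ∀ i → E colours (λ b → error b i (lookup b i)) ≤ α
    error-own-block i = begin
      E colours (λ b → error b i (lookup b i))
        ≡⟨ E-resample (fin k) i (λ b → error b i (lookup b i)) ⟩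
      E colours (λ b → E (fin k) (λ a → error (b [ i ]≔ a) i (lookup (b [ i ]≔ a) i)))
        ≡⟨ E-cong colours (λ b → E-cong (fin k) λ a →
             trans (error-recolour b i a _) (cong (error b i) (lookup∘update i b a))) ⟩
      E colours (λ b → E (fin k) (error b i))
        ≤⟨ E-mono colours (λ b → error-mean b i) ⟩
      E colours (λ _ → α)
        ≡⟨ E-const colours α ⟩
      α ∎
      where open ≤-Reasoning

    -- The parameter `ρ` stays free here; it is chosen later to balance the two summands of the
    -- first term.
    sensitivity-step : ∀ {ρ r} → 0ℚ ≤ ρ → ρ * r ≡ 1ℚ → averageSensitivity (sgn s ∘ p) ≤
      ½ * (ρ * ℕtoℚ n + ℕtoℚ (suc k) * r) + 2ℚ * (α * ℕtoℚ n)
    sensitivity-step {ρ} {r} 0≤ρ ρr≡1 = begin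
      averageSensitivity f
        ≡⟨ E-const colours (averageSensitivity f) ⟨
      E colours (λ _ → averageSensitivity f)
        ≤⟨ E-mono colours (λ b → partition-bound b 0≤ρ ρr≡1) ⟩
      E colours (λ b → c + 2ℚ * sumFin n (λ i → error b i (lookup b i)))
        ≡⟨ L-+ (linear colours) (λ _ → c) _ ⟩
      E colours (λ _ → c) + E colours (λ b → 2ℚ * sumFin n (λ i → error b i (lookup b i)))
        ≡⟨ cong₂ _+_ (E-const colours c) (trans (L-* (linear colours) 2ℚ _)
             (cong (2ℚ *_) (L-sumFin (linear colours) n _))) ⟩
      c + 2ℚ * sumFin n (λ i → E colours (λ b → error b i (lookup b i)))
        ≤⟨ +-monoʳ-≤ c (*-monoˡ-≤-nonNeg 2ℚ (sumFin-mono n error-own-block)) ⟩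
      c + 2ℚ * sumFin n (λ _ → α)
        ≡⟨ cong (λ a → c + 2ℚ * a) (trans (sumFin-const n α) (*-comm (ℕtoℚ n) α)) ⟩
      c + 2ℚ * (α * ℕtoℚ n) ∎
      where
      open ≤-Reasoning
      c = ½ * (ρ * ℕtoℚ n + ℕtoℚ (suc k) * r)

  -- Iterating the recursion down to degree 0

  differ-refl : ∀ a → differ a a ≡ false
  differ-refl true  = refl
  differ-refl false = refl

  degree0-insensitive : ∀ s {p : Cube n → ℚ} → Degree≤ 0 p → averageSensitivity (sgn s ∘ p) ≡ 0ℚ
  degree0-insensitive {n} s {p} P = trans (L-cong (sumFin-linear n) λ i → trans
      (influence-mean (sgn s ∘ p) i)
      (trans (E-cong (cube n) λ x → cong ind (trans
          (cong (λ q → differ (sgn s (p x)) (sgn s q)) (degree0-constant P (flipAt i x) x))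
          (differ-refl (sgn s (p x)))))
        (E-const (cube n) 0ℚ)))
    (L-0 (sumFin-linear n))

  ℕtoℚ-mono : ∀ {a b} → a ℕ.≤ b → ℕtoℚ a ≤ ℕtoℚ b
  ℕtoℚ-mono {b = b} z≤n = nonNegative⁻¹ (ℕtoℚ b) {{ℕtoℚ-nonNeg b}}
  ℕtoℚ-mono (s≤s a≤b)   = +-monoʳ-≤ 1ℚ (ℕtoℚ-mono a≤b)

  rate : ℚ → ℕ → ℚ
  rate ρ zero    = 0ℚ
  rate ρ (suc d) = ρ + 2ℚ * rate ρ d

  -- Adding `ρ` turns the affine recursion into pure doubling; the solution is `ρ` times 2^d - 1.
  rate-closed : ∀ ρ d → rate ρ d + ρ ≡ ℕtoℚ (2 ℕ.^ d) * ρ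
  rate-closed ρ zero    = solve 1 (λ ρ → con 0ℚ :+ ρ := con 1ℚ :* ρ) refl ρ
  rate-closed ρ (suc d) = begin
    (ρ + 2ℚ * rate ρ d) + ρ
      ≡⟨ solve 2 (λ a b → (a :+ con 2ℚ :* b) :+ a := con 2ℚ :* (b :+ a)) refl ρ (rate ρ d) ⟩
    2ℚ * (rate ρ d + ρ)
      ≡⟨ cong (2ℚ *_) (rate-closed ρ d) ⟩
    2ℚ * (ℕtoℚ (2 ℕ.^ d) * ρ)
      ≡⟨ *-assoc 2ℚ (ℕtoℚ (2 ℕ.^ d)) ρ ⟨
    2ℚ * ℕtoℚ (2 ℕ.^ d) * ρ
      ≡⟨ cong (_* ρ) (ℕtoℚ-* 2 (2 ℕ.^ d)) ⟨
    ℕtoℚ (2 ℕ.^ suc d) * ρ ∎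
    where open ≡-Reasoning

  -- The chain of dimensions 1, r², r⁴, …, r²ᵈ ≤ n makes all the errors of the recursion
  -- comparable to 1/r, where r = suc l.
  sensitivity-rate : ∀ s d l {n} → (suc l ℕ.* suc l) ℕ.^ d ℕ.≤ n → {p : Cube n → ℚ} → Degree≤ d p →
    averageSensitivity (sgn s ∘ p) ≤ rate (recip l) d * ℕtoℚ n
  sensitivity-rate s zero    l {n} _ P =
    ≤-reflexive (trans (degree0-insensitive s P) (sym (*-zeroˡ (ℕtoℚ n))))
  sensitivity-rate s (suc d) l {n} r²ᵈ≤n {p} P with (suc l ℕ.* suc l) ℕ.^ d in eq
  ... | zero  = ⊥-elim (ℕ.≢-nonZero⁻¹ _ {{ℕ.m^n≢0 (suc l ℕ.* suc l) d}} eq)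
  -- `suc k` is r²ᵈ. It is both the number of colours and the dimension at which the induction
  -- hypothesis is used, whose size condition then holds with equality.
  ... | suc k = begin
    averageSensitivity (sgn s ∘ p)
      ≤⟨ sensitivity-step s P {α} (sensitivity-rate s d l (ℕ.≤-reflexive eq)) {ρ} {r} 0≤ρ (recip-* l) ⟩
    ½ * (ρ * ℕtoℚ n + ℕtoℚ (suc k) * r) + 2ℚ * (α * ℕtoℚ n)
      ≤⟨ +-monoˡ-≤ (2ℚ * (α * ℕtoℚ n)) (*-monoˡ-≤-nonNeg ½ (+-monoʳ-≤ (ρ * ℕtoℚ n) few-blocks)) ⟩
    ½ * (ρ * ℕtoℚ n + ρ * ℕtoℚ n) + 2ℚ * (α * ℕtoℚ n)
      ≡⟨ solve 3 (λ a b n → con ½ :* (a :* n :+ a :* n) :+ con 2ℚ :* (b :* n) :=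
           (a :+ con 2ℚ :* b) :* n) refl ρ α (ℕtoℚ n) ⟩
    rate ρ (suc d) * ℕtoℚ n ∎
    where
    open ≤-Reasoning
    ρ = recip l
    r = ℕtoℚ (suc l)
    α = rate ρ d
    0≤ρ : 0ℚ ≤ ρ
    0≤ρ = <⇒≤ (positive⁻¹ ρ {{recip-pos l}})
    -- After multiplying by r this is the hypothesis r² · r²ᵈ ≤ n; it makes the cost of the blocks
    -- no larger than the second-moment term.
    few-blocks : ℕtoℚ (suc k) * r ≤ ρ * ℕtoℚ n
    few-blocks = begin
      ℕtoℚ (suc k) * r
        ≡⟨ *-identityˡ _ ⟨
      1ℚ * (ℕtoℚ (suc k) * r)
        ≡⟨ cong (_* (ℕtoℚ (suc k) * r)) (recip-* l) ⟨
      ρ * r * (ℕtoℚ (suc k) * r)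
        ≡⟨ solve 3 (λ ρ r k → ρ :* r :* (k :* r) := ρ :* ((r :* r) :* k)) refl ρ r (ℕtoℚ (suc k)) ⟩
      ρ * (r * r * ℕtoℚ (suc k))
        ≡⟨ cong (ρ *_) (trans (ℕtoℚ-* (suc l ℕ.* suc l) (suc k))
             (cong (_* ℕtoℚ (suc k)) (ℕtoℚ-* (suc l) (suc l)))) ⟨
      ρ * ℕtoℚ (suc l ℕ.* suc l ℕ.* suc k)
        ≤⟨ *-monoˡ-≤-nonNeg ρ {{nonNegative 0≤ρ}} (ℕtoℚ-mono r²ᵈ≤n) ⟩
      ρ * ℕtoℚ n ∎

  -- From the rate to the stated power of `n`

  influence-nonNeg : ∀ (f : Cube n → Bool) i → 0ℚ ≤ influence f i
  influence-nonNeg {n} f i = begin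
    0ℚ                   ≡⟨ E-const (cube n) 0ℚ ⟨
    E (cube n) (λ _ → 0ℚ) ≤⟨ E-mono (cube n) (λ x → 0≤ind (differ (f x) (f (flipAt i x)))) ⟩
    _                    ≡⟨ influence-mean f i ⟨
    influence f i        ∎
    where
    open ≤-Reasoning
    0≤ind : ∀ a → 0ℚ ≤ ind a
    0≤ind true  = ≤ᵇ⇒≤ _
    0≤ind false = ≤ᵇ⇒≤ _

  influence-≤1 : ∀ (f : Cube n → Bool) i → influence f i ≤ 1ℚ
  influence-≤1 {n} f i = begin
    influence f i        ≡⟨ influence-mean f i ⟩
    _                    ≤⟨ E-mono (cube n) (λ x → ind≤1 (differ (f x) (f (flipAt i x)))) ⟩
    E (cube n) (λ _ → 1ℚ) ≡⟨ E-const (cube n) 1ℚ ⟩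
    1ℚ                   ∎
    where
    open ≤-Reasoning
    ind≤1 : ∀ a → ind a ≤ 1ℚ
    ind≤1 true  = ≤ᵇ⇒≤ _
    ind≤1 false = ≤ᵇ⇒≤ _

  sensitivity-nonNeg : ∀ (f : Cube n → Bool) → 0ℚ ≤ averageSensitivity f
  sensitivity-nonNeg {n} f = subst (_≤ averageSensitivity f) (L-0 (sumFin-linear n))
    (sumFin-mono n (influence-nonNeg f))

  sensitivity-≤n : ∀ (f : Cube n → Bool) → averageSensitivity f ≤ ℕtoℚ n
  sensitivity-≤n {n} f = subst (averageSensitivity f ≤_)
    (trans (sumFin-const n 1ℚ) (*-identityʳ (ℕtoℚ n))) (sumFin-mono n (influence-≤1 f))

  ^-+ : ∀ a m n → a ^ℚ (m ℕ.+ n) ≡ a ^ℚ m * a ^ℚ n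
  ^-+ a zero    n = sym (*-identityˡ (a ^ℚ n))
  ^-+ a (suc m) n = trans (cong (a *_) (^-+ a m n)) (sym (*-assoc a (a ^ℚ m) (a ^ℚ n)))

  ^-* : ∀ a b n → (a * b) ^ℚ n ≡ a ^ℚ n * b ^ℚ n
  ^-* a b zero    = refl
  ^-* a b (suc n) = trans (cong (a * b *_) (^-* a b n))
    (solve 4 (λ a b c d → a :* b :* (c :* d) := (a :* c) :* (b :* d)) refl a b (a ^ℚ n) (b ^ℚ n))

  ℕtoℚ-^ : ∀ a n → ℕtoℚ (a ℕ.^ n) ≡ ℕtoℚ a ^ℚ n
  ℕtoℚ-^ a zero    = refl
  ℕtoℚ-^ a (suc n) = trans (ℕtoℚ-* a (a ℕ.^ n)) (cong (ℕtoℚ a *_) (ℕtoℚ-^ a n))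

  *-mono-≤-nonNeg : ∀ {a b c d} → 0ℚ ≤ b → 0ℚ ≤ c → a ≤ b → c ≤ d → a * c ≤ b * d
  *-mono-≤-nonNeg {b = b} {c = c} 0≤b 0≤c a≤b c≤d = ≤-trans
    (*-monoʳ-≤-nonNeg c {{nonNegative 0≤c}} a≤b) (*-monoˡ-≤-nonNeg b {{nonNegative 0≤b}} c≤d)

  0≤* : ∀ {a b} → 0ℚ ≤ a → 0ℚ ≤ b → 0ℚ ≤ a * b
  0≤* {a} 0≤a 0≤b = subst (_≤ a * _) (*-zeroʳ a) (*-monoˡ-≤-nonNeg a {{nonNegative 0≤a}} 0≤b)

  0≤^ : ∀ {a} → 0ℚ ≤ a → ∀ n → 0ℚ ≤ a ^ℚ n
  0≤^ 0≤a zero    = ≤ᵇ⇒≤ _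
  0≤^ 0≤a (suc n) = 0≤* 0≤a (0≤^ 0≤a n)

  ^-mono-≤ : ∀ {a b} → 0ℚ ≤ a → a ≤ b → ∀ n → a ^ℚ n ≤ b ^ℚ n
  ^-mono-≤ 0≤a a≤b zero    = ≤-refl
  ^-mono-≤ 0≤a a≤b (suc n) =
    *-mono-≤-nonNeg (≤-trans 0≤a a≤b) (0≤^ 0≤a n) a≤b (^-mono-≤ 0≤a a≤b n)

  -- Induct on `n` upwards from `q 0`, advancing `r` exactly when `n` reaches the next value of `q`.
  inverse-of-strictly-increasing : ∀ (q : ℕ → ℕ) → (∀ r → q r ℕ.< q (suc r)) →
    ∀ {n} → q 0 ℕ.≤ n → ∃[ r ] q r ℕ.≤ n × n ℕ.< q (suc r)
  inverse-of-strictly-increasing q inc q0≤n = go (ℕ.≤⇒≤′ q0≤n)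
    where
    go : ∀ {n} → q 0 ℕ.≤′ n → ∃[ r ] q r ℕ.≤ n × n ℕ.< q (suc r)
    go (ℕ.≤′-reflexive refl) = 0 , ℕ.≤-refl , inc 0
    go (ℕ.≤′-step {n} q0≤n) with go q0≤n
    ... | r , qr≤n , n<q with q (suc r) ℕ.≤? suc n
    ...   | yes q≤sn = suc r , q≤sn , ℕ.≤-<-trans n<q (inc (suc r))
    ...   | no  q≰sn = r , ℕ.m≤n⇒m≤1+n qr≤n , ℕ.≰⇒> q≰sn

  -- `suc l` is the integer part of the 2d-th root of `n`. As it is at least 1, its successor is at
  -- most its double, whence the factor 4 after squaring.
  even-root : ∀ d n .{{_ : ℕ.NonZero d}} .{{_ : ℕ.NonZero n}} →
    ∃[ l ] (suc l ℕ.* suc l) ℕ.^ d ℕ.≤ n × n ℕ.≤ (4 ℕ.* (suc l ℕ.* suc l)) ℕ.^ d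
  even-root d n with inverse-of-strictly-increasing (λ l → (suc l ℕ.* suc l) ℕ.^ d)
      (λ l → ℕ.^-monoˡ-< d (ℕ.*-mono-< (ℕ.n<1+n (suc l)) (ℕ.n<1+n (suc l))))
      (subst (ℕ._≤ n) (sym (ℕ.^-zeroˡ d)) (ℕ.>-nonZero⁻¹ n))
  ... | l , l≤ , <l = l , l≤ , ℕ.≤-trans (ℕ.<⇒≤ <l) (ℕ.^-monoˡ-≤ d (begin
    suc (suc l) ℕ.* suc (suc l)          ≤⟨ ℕ.*-mono-≤ double double ⟩
    (2 ℕ.* suc l) ℕ.* (2 ℕ.* suc l)      ≡⟨ ℕ.[m*n]*[o*p]≡[m*o]*[n*p] 2 (suc l) 2 (suc l) ⟩
    4 ℕ.* (suc l ℕ.* suc l)              ∎))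
    where
    open ℕ.≤-Reasoning
    double : suc (suc l) ℕ.≤ 2 ℕ.* suc l
    double = subst (suc (suc l) ℕ.≤_) (cong (suc l ℕ.+_) (sym (ℕ.+-identityʳ (suc l))))
      (s≤s (ℕ.m≤n+m (suc l) l))

  averageSensitivity-cong : ∀ {f g : Cube n → Bool} → (∀ x → f x ≡ g x) →
    averageSensitivity f ≡ averageSensitivity g
  averageSensitivity-cong {n} {f} {g} f≗g = L-cong (sumFin-linear n) λ i → trans (influence-mean f i)
    (trans (E-cong (cube n) λ x → cong₂ (λ a b → ind (differ a b)) (f≗g x) (f≗g (flipAt i x)))
      (sym (influence-mean g i)))

  -- Of the 4d + 6 factors `S`, bound 2d by the rate and the other 2d + 6 by the trivial bound `n`.
  -- One factor `n` is spent against r to the power -2d, leaving 4^d by the choice of r; the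
  -- remaining powers of `n` have total exponent 4d + 5.
  power-bound : ∀ d l n {S} → 0ℚ ≤ S → S ≤ ℕtoℚ n → n ℕ.≤ (4 ℕ.* (suc l ℕ.* suc l)) ℕ.^ d →
    S ≤ ℕtoℚ (2 ℕ.^ d) * recip l * ℕtoℚ n →
    S ^ℚ (4 ℕ.* d ℕ.+ 6) ≤ ℕtoℚ (((2 ℕ.^ d) ℕ.^ d ℕ.* (2 ℕ.^ d) ℕ.^ d ℕ.* 4 ℕ.^ d) ℕ.* n ℕ.^ (4 ℕ.* d ℕ.+ 5))
  power-bound d l n {S} 0≤S S≤N n≤ S≤ = begin
    S ^ℚ (4 ℕ.* d ℕ.+ 6)
      ≡⟨ cong (S ^ℚ_) (ℕ-solve 1 (λ d → ℕcon 4 ℕ:* d ℕ:+ ℕcon 6 ℕ:= (d ℕ:+ d) ℕ:+ (ℕcon 6 ℕ:+ ℕcon 2 ℕ:* d)) refl d) ⟩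
    S ^ℚ ((d ℕ.+ d) ℕ.+ e)
      ≡⟨ trans (^-+ S (d ℕ.+ d) e) (cong (_* S ^ℚ e) (^-+ S d d)) ⟩
    S ^ℚ d * S ^ℚ d * S ^ℚ e
      ≤⟨ *-mono-≤-nonNeg (0≤* 0≤Bᵈ 0≤Bᵈ) (0≤^ 0≤S e)
           (*-mono-≤-nonNeg 0≤Bᵈ (0≤^ 0≤S d) S≤Bᵈ S≤Bᵈ) (^-mono-≤ 0≤S S≤N e) ⟩
    (T * ρ * N) ^ℚ d * (T * ρ * N) ^ℚ d * (N * N ^ℚ e′)
      ≡⟨ cong (λ a → a * a * (N * N ^ℚ e′)) (trans (^-* (T * ρ) N d) (cong (_* N ^ℚ d) (^-* T ρ d))) ⟩
    (T ^ℚ d * ρ ^ℚ d * N ^ℚ d) * (T ^ℚ d * ρ ^ℚ d * N ^ℚ d) * (N * N ^ℚ e′)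
      ≡⟨ solve 5 (λ t ρ a n b → (t :* ρ :* a) :* (t :* ρ :* a) :* (n :* b) :=
           (t :* t :* (a :* a :* b)) :* (ρ :* ρ :* n)) refl (T ^ℚ d) (ρ ^ℚ d) (N ^ℚ d) N (N ^ℚ e′) ⟩
    (T ^ℚ d * T ^ℚ d * (N ^ℚ d * N ^ℚ d * N ^ℚ e′)) * (ρ ^ℚ d * ρ ^ℚ d * N)
      ≤⟨ *-monoˡ-≤-nonNeg (T ^ℚ d * T ^ℚ d * (N ^ℚ d * N ^ℚ d * N ^ℚ e′))
           {{nonNegative (0≤* (0≤* 0≤Tᵈ 0≤Tᵈ) (0≤* (0≤* (0≤^ 0≤N d) (0≤^ 0≤N d)) (0≤^ 0≤N e′)))}} ρᵈρᵈN≤4ᵈ ⟩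
    (T ^ℚ d * T ^ℚ d * (N ^ℚ d * N ^ℚ d * N ^ℚ e′)) * ℕtoℚ 4 ^ℚ d
      ≡⟨ solve 4 (λ t a b f → (t :* t :* (a :* a :* b)) :* f := (t :* t :* f) :* (a :* a :* b)) refl
           (T ^ℚ d) (N ^ℚ d) (N ^ℚ e′) (ℕtoℚ 4 ^ℚ d) ⟩
    (T ^ℚ d * T ^ℚ d * ℕtoℚ 4 ^ℚ d) * (N ^ℚ d * N ^ℚ d * N ^ℚ e′)
      ≡⟨ cong₂ _*_ constants dimensions ⟩
    ℕtoℚ K * ℕtoℚ (n ℕ.^ (4 ℕ.* d ℕ.+ 5))
      ≡⟨ ℕtoℚ-* K (n ℕ.^ (4 ℕ.* d ℕ.+ 5)) ⟨
    ℕtoℚ (K ℕ.* n ℕ.^ (4 ℕ.* d ℕ.+ 5)) ∎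
    where
    open ≤-Reasoning
    e e′ K : ℕ
    e = 6 ℕ.+ 2 ℕ.* d
    e′ = 5 ℕ.+ 2 ℕ.* d
    K = (2 ℕ.^ d) ℕ.^ d ℕ.* (2 ℕ.^ d) ℕ.^ d ℕ.* 4 ℕ.^ d
    T ρ N R : ℚ
    T = ℕtoℚ (2 ℕ.^ d)
    ρ = recip l
    N = ℕtoℚ n
    R = ℕtoℚ (suc l)

    0≤ℕtoℚ : ∀ a → 0ℚ ≤ ℕtoℚ a
    0≤ℕtoℚ a = ℕtoℚ-mono (z≤n {a})
    0≤N = 0≤ℕtoℚ n
    0≤ρ : 0ℚ ≤ ρ
    0≤ρ = <⇒≤ (positive⁻¹ ρ {{recip-pos l}})
    0≤Tᵈ = 0≤^ (0≤ℕtoℚ (2 ℕ.^ d)) d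
    0≤Bᵈ = 0≤^ (0≤* (0≤* (0≤ℕtoℚ (2 ℕ.^ d)) 0≤ρ) 0≤N) d
    S≤Bᵈ = ^-mono-≤ 0≤S S≤ d

    ρᵈρᵈN≤4ᵈ : ρ ^ℚ d * ρ ^ℚ d * N ≤ ℕtoℚ 4 ^ℚ d
    ρᵈρᵈN≤4ᵈ = begin
      ρ ^ℚ d * ρ ^ℚ d * N
        ≤⟨ *-monoˡ-≤-nonNeg (ρ ^ℚ d * ρ ^ℚ d) {{nonNegative (0≤* (0≤^ 0≤ρ d) (0≤^ 0≤ρ d))}} (ℕtoℚ-mono n≤) ⟩
      ρ ^ℚ d * ρ ^ℚ d * ℕtoℚ ((4 ℕ.* (suc l ℕ.* suc l)) ℕ.^ d)
        ≡⟨ cong (ρ ^ℚ d * ρ ^ℚ d *_) (trans (ℕtoℚ-^ _ d) (cong (_^ℚ d)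
             (trans (ℕtoℚ-* 4 (suc l ℕ.* suc l)) (cong (ℕtoℚ 4 *_) (ℕtoℚ-* (suc l) (suc l)))))) ⟩
      ρ ^ℚ d * ρ ^ℚ d * (ℕtoℚ 4 * (R * R)) ^ℚ d
        ≡⟨ cong (_* (ℕtoℚ 4 * (R * R)) ^ℚ d) (^-* ρ ρ d) ⟨
      (ρ * ρ) ^ℚ d * (ℕtoℚ 4 * (R * R)) ^ℚ d
        ≡⟨ ^-* (ρ * ρ) (ℕtoℚ 4 * (R * R)) d ⟨
      (ρ * ρ * (ℕtoℚ 4 * (R * R))) ^ℚ d
        ≡⟨ cong (_^ℚ d) (trans
             (solve 3 (λ ρ f r → ρ :* ρ :* (f :* (r :* r)) := f :* ((ρ :* r) :* (ρ :* r))) refl ρ (ℕtoℚ 4) R)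
             (cong (λ a → ℕtoℚ 4 * (a * a)) (recip-* l))) ⟩
      ℕtoℚ 4 ^ℚ d ∎

    constants : T ^ℚ d * T ^ℚ d * ℕtoℚ 4 ^ℚ d ≡ ℕtoℚ K
    constants = sym (trans (ℕtoℚ-* ((2 ℕ.^ d) ℕ.^ d ℕ.* (2 ℕ.^ d) ℕ.^ d) (4 ℕ.^ d))
      (cong₂ _*_ (trans (ℕtoℚ-* ((2 ℕ.^ d) ℕ.^ d) _) (cong₂ _*_ (ℕtoℚ-^ (2 ℕ.^ d) d) (ℕtoℚ-^ (2 ℕ.^ d) d)))
        (ℕtoℚ-^ 4 d)))

    dimensions : N ^ℚ d * N ^ℚ d * N ^ℚ e′ ≡ ℕtoℚ (n ℕ.^ (4 ℕ.* d ℕ.+ 5))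
    dimensions = sym (trans (ℕtoℚ-^ n (4 ℕ.* d ℕ.+ 5)) (trans
      (cong (N ^ℚ_) (ℕ-solve 1 (λ d → ℕcon 4 ℕ:* d ℕ:+ ℕcon 5 ℕ:= (d ℕ:+ d) ℕ:+ (ℕcon 5 ℕ:+ ℕcon 2 ℕ:* d)) refl d))
      (trans (^-+ N (d ℕ.+ d) e′) (cong (_* N ^ℚ e′) (^-+ N d d)))))

  -- In base 2 the exponents are 2d² + 2d and 4d² + 6d, so the constant 1 suffices.
  constant-bound : ∀ d → (2 ℕ.^ d) ℕ.^ d ℕ.* (2 ℕ.^ d) ℕ.^ d ℕ.* 4 ℕ.^ d ℕ.≤ 2 ℕ.^ (1 ℕ.* d ℕ.* (4 ℕ.* d ℕ.+ 6))
  constant-bound d = begin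
    (2 ℕ.^ d) ℕ.^ d ℕ.* (2 ℕ.^ d) ℕ.^ d ℕ.* (2 ℕ.^ 2) ℕ.^ d
      ≡⟨ cong₂ (λ a b → a ℕ.* a ℕ.* b) (ℕ.^-*-assoc 2 d d) (ℕ.^-*-assoc 2 2 d) ⟩
    2 ℕ.^ (d ℕ.* d) ℕ.* 2 ℕ.^ (d ℕ.* d) ℕ.* 2 ℕ.^ (2 ℕ.* d)
      ≡⟨ trans (cong (ℕ._* 2 ℕ.^ (2 ℕ.* d)) (sym (ℕ.^-distribˡ-+-* 2 (d ℕ.* d) (d ℕ.* d))))
           (sym (ℕ.^-distribˡ-+-* 2 (d ℕ.* d ℕ.+ d ℕ.* d) (2 ℕ.* d))) ⟩
    2 ℕ.^ (d ℕ.* d ℕ.+ d ℕ.* d ℕ.+ 2 ℕ.* d)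
      ≤⟨ ℕ.^-monoʳ-≤ 2 (ℕ.m≤m+n (d ℕ.* d ℕ.+ d ℕ.* d ℕ.+ 2 ℕ.* d) (2 ℕ.* (d ℕ.* d) ℕ.+ 4 ℕ.* d)) ⟩
    2 ℕ.^ (d ℕ.* d ℕ.+ d ℕ.* d ℕ.+ 2 ℕ.* d ℕ.+ (2 ℕ.* (d ℕ.* d) ℕ.+ 4 ℕ.* d))
      ≡⟨ cong (2 ℕ.^_) (ℕ-solve 1 (λ d →
           d ℕ:* d ℕ:+ d ℕ:* d ℕ:+ ℕcon 2 ℕ:* d ℕ:+ (ℕcon 2 ℕ:* (d ℕ:* d) ℕ:+ ℕcon 4 ℕ:* d) ℕ:=
           ℕcon 1 ℕ:* d ℕ:* (ℕcon 4 ℕ:* d ℕ:+ ℕcon 6)) refl d) ⟩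
    2 ℕ.^ (1 ℕ.* d ℕ.* (4 ℕ.* d ℕ.+ 6)) ∎
    where
    open ℕ.≤-Reasoning

  PTF-sensitivity-rate : ∀ (s : Bool) d l {n} {f : Cube n → Bool} → IsPTF s d f →
    (suc l ℕ.* suc l) ℕ.^ d ℕ.≤ n → averageSensitivity f ≤ ℕtoℚ (2 ℕ.^ d) * recip l * ℕtoℚ n
  PTF-sensitivity-rate s d l {n} {f} (P , degree , f≗) r²ᵈ≤n = begin
    averageSensitivity f
      ≡⟨ averageSensitivity-cong f≗ ⟩
    averageSensitivity (sgn s ∘ evalPoly P)
      ≤⟨ sensitivity-rate s d l r²ᵈ≤n (evalPoly-degree degree) ⟩
    rate ρ d * ℕtoℚ n
      ≤⟨ *-monoʳ-≤-nonNeg (ℕtoℚ n) {{ℕtoℚ-nonNeg n}} rate≤ ⟩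
    ℕtoℚ (2 ℕ.^ d) * ρ * ℕtoℚ n ∎
    where
    open ≤-Reasoning
    ρ = recip l
    rate≤ : rate ρ d ≤ ℕtoℚ (2 ℕ.^ d) * ρ
    rate≤ = begin
      rate ρ d                ≡⟨ +-identityʳ _ ⟨
      rate ρ d + 0ℚ           ≤⟨ +-monoʳ-≤ (rate ρ d) (<⇒≤ (positive⁻¹ ρ {{recip-pos l}})) ⟩
      rate ρ d + ρ            ≡⟨ rate-closed ρ d ⟩
      ℕtoℚ (2 ℕ.^ d) * ρ      ∎

  PTF-sensitivity-nonZero : ∀ s d n .{{_ : ℕ.NonZero d}} .{{_ : ℕ.NonZero n}} (f : Cube n → Bool) →
    IsPTF s d f → averageSensitivity f ^ℚ (4 ℕ.* d ℕ.+ 6)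
      ≤ ℕtoℚ (2 ℕ.^ (1 ℕ.* d ℕ.* (4 ℕ.* d ℕ.+ 6)) ℕ.* n ℕ.^ (4 ℕ.* d ℕ.+ 5))
  PTF-sensitivity-nonZero s d n f ptf = let l , r²ᵈ≤n , n≤ = even-root d n in ≤-trans
    (power-bound d l n (sensitivity-nonNeg f) (sensitivity-≤n f) n≤ (PTF-sensitivity-rate s d l ptf r²ᵈ≤n))
    (ℕtoℚ-mono (ℕ.*-monoˡ-≤ (n ℕ.^ (4 ℕ.* d ℕ.+ 5)) (constant-bound d)))

  -- Both sides of the real inequality are raised to the power 4d + 6, which clears the fractional
  -- exponent; nothing is lost because average sensitivity is nonnegative.
  PTF-sensitivity : ∀ s d → 1 ℕ.≤ d → ∀ n (f : Cube n → Bool) →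
    IsPTF s d f → averageSensitivity f ^ℚ (4 ℕ.* d ℕ.+ 6)
      ≤ ℕtoℚ (2 ℕ.^ (1 ℕ.* d ℕ.* (4 ℕ.* d ℕ.+ 6)) ℕ.* n ℕ.^ (4 ℕ.* d ℕ.+ 5))
  -- `even-root` needs a nonzero dimension. In dimension 0 the sum of influences is empty, and a
  -- positive power of 0 is 0.
  PTF-sensitivity s d 1≤d zero f _ = ≤-trans
    (≤-reflexive (trans (^-+ 0ℚ (4 ℕ.* d) 6) (*-zeroʳ (0ℚ ^ℚ (4 ℕ.* d)))))
    (ℕtoℚ-mono {b = 2 ℕ.^ (1 ℕ.* d ℕ.* (4 ℕ.* d ℕ.+ 6)) ℕ.* 0 ℕ.^ (4 ℕ.* d ℕ.+ 5)} z≤n)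
  PTF-sensitivity s d 1≤d (suc n) f ptf = PTF-sensitivity-nonZero s d (suc n) {{ℕ.>-nonZero 1≤d}} f ptf

open import Data.Nat using (_+_; _*_; _^_)

mainTheorem3 : Σ ℕ λ C → (0 ℕ.< C) ×
    ((s0 : Bool) (d : ℕ) → 1 ℕ.≤ d → (n : ℕ) (f : Cube n → Bool) → IsPTF s0 d f →
    averageSensitivity f ^ℚ (4 * d + 6)
    ≤ ℕtoℚ (2 ^ (C * d * (4 * d + 6)) * n ^ (4 * d + 5)))
mainTheorem3 = 1 , s≤s z≤n , Sensitivity.PTF-sensitivity
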